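{- Let $a,b$ be given nonnegative integers and $\alpha=\frac{1+\sqrt5}{2}$. Then, as $n\to\infty$, $$G^+_{1,0,a,b}(n)=2^{ -a}\,5^{ -(a+b+1)/2}\,n^{2a+b}\,\alpha^{n+2-a-b}+O(n^{2a+b-1}\alpha^n).$$
   Context: For $n\ge0$ let $\mathcal{A}_{1,n}=\{(1,j):1\le j\le n\}$, and let $\mathcal{B}^+_{1,n}$ be the set of subsets $I\subseteq\mathcal{A}_{1,n}$ such that $(1,j)\in I$ with $1\le j\le n-1$ implies $(1,j+1)\notin I$ (i.e. subsets of $\{1,\dots,n\}$ with no two consecutive elements). For such $I$, $|I|$ is its cardinality and $\sigma_0(I)=\sum_{(1,j)\in I}j$. Define $G^+_{1,0,a,b}(n)=\sum_{I\in\mathcal{B}^+_{1,n}}\sigma_0(I)^a|I|^b$ (with $0^0=1$). -}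

module Defs where

open import Data.Bool using (Bool; true; false; not; _∧_; _∨_; if_then_else_)
open import Data.Nat as ℕ using (ℕ; zero; suc)
open import Data.List using (List; []; _∷_; [_]; map; _++_; filter; length; upTo; foldr)
open import Data.Nat.ListAction using (sum)
open import Data.Integer using (+_)
open import Data.Rational as ℚ using (ℚ; _/_; 0ℚ; 1ℚ; ½)
open import Data.Product using (_×_; _,_)
open import Data.Sum using (_⊎_)
open import Relation.Nullary.Decidable using (⌊_⌋)
open import Relation.Binary.PropositionalEquality using (_≡_)

subsets : List ℕ → List (List ℕ)
subsets [] = [ [] ]
subsets (x ∷ xs) = map (x ∷_) (subsets xs) ++ subsets xs

_∈ᵇ_ : ℕ → List ℕ → Bool
x ∈ᵇ [] = false
x ∈ᵇ (y ∷ ys) = ⌊ x ℕ.≟ y ⌋ ∨ (x ∈ᵇ ys)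

noConsecutive : List ℕ → Bool
noConsecutive I = foldr (λ j r → not (suc j ∈ᵇ I) ∧ r) true I

-- the index set A_{1,n} = {1,...,n} (identifying (1,j) with j)
A1 : ℕ → List ℕ
A1 n = map suc (upTo n)

B⁺ : ℕ → List (List ℕ)
B⁺ n = filter (λ I → noConsecutive I Data.Bool.≟ true) (subsets (A1 n))

σ₀ : List ℕ → ℕ
σ₀ I = sum I

-- G⁺_{1,0,a,b}(n) = Σ_{I ∈ B⁺_{1,n}} σ₀(I)^a |I|^b   (ℕ._^_ has 0^0 = 1)
G⁺ : ℕ → ℕ → ℕ → ℕ
G⁺ a b n = sum (map (λ I → (σ₀ I ℕ.^ a) ℕ.* (length I ℕ.^ b)) (B⁺ n))

-- ⟨ x , y ⟩ represents the real number x + y·√5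
record Q5 : Set where
  constructor ⟨_,_⟩
  field
    re : ℚ
    im : ℚ
open Q5 public

fromℚ : ℚ → Q5
fromℚ q = ⟨ q , 0ℚ ⟩

fromℕ : ℕ → Q5
fromℕ n = fromℚ (+ n / 1)

infixl 6 _+₅_ _-₅_
infixl 7 _*₅_

_+₅_ : Q5 → Q5 → Q5
⟨ a , b ⟩ +₅ ⟨ c , d ⟩ = ⟨ a ℚ.+ c , b ℚ.+ d ⟩

-₅_ : Q5 → Q5
-₅ ⟨ a , b ⟩ = ⟨ ℚ.- a , ℚ.- b ⟩

_-₅_ : Q5 → Q5 → Q5
x -₅ y = x +₅ (-₅ y)

-- (a + b√5)(c + d√5) = (ac + 5bd) + (ad + bc)√5
_*₅_ : Q5 → Q5 → Q5
⟨ a , b ⟩ *₅ ⟨ c , d ⟩ = ⟨ a ℚ.* c ℚ.+ (+ 5 / 1) ℚ.* (b ℚ.* d) , a ℚ.* d ℚ.+ b ℚ.* c ⟩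

_^₅_ : Q5 → ℕ → Q5
x ^₅ zero = fromℚ 1ℚ
x ^₅ suc n = x *₅ (x ^₅ n)

√5 : Q5
√5 = ⟨ 0ℚ , 1ℚ ⟩

α : Q5
α = ⟨ ½ , ½ ⟩

α⁻¹ : Q5
α⁻¹ = ⟨ ℚ.- ½ , ½ ⟩

√5⁻¹ : Q5
√5⁻¹ = ⟨ 0ℚ , + 1 / 5 ⟩

-- x + y√5 ≥ 0 as a real number
NonNeg : Q5 → Set
NonNeg ⟨ x , y ⟩ =
    (0ℚ ℚ.≤ x × 0ℚ ℚ.≤ y)
  ⊎ (0ℚ ℚ.≤ x × (+ 5 / 1) ℚ.* (y ℚ.* y) ℚ.≤ x ℚ.* x)
  ⊎ (0ℚ ℚ.≤ y × x ℚ.* x ℚ.≤ (+ 5 / 1) ℚ.* (y ℚ.* y))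

_≤₅_ : Q5 → Q5 → Set
u ≤₅ v = NonNeg (v -₅ u)

AbsLe : Q5 → Q5 → Set
AbsLe d e = ((-₅ e) ≤₅ d) × (d ≤₅ e)

-- main term 2^{-a} 5^{-(a+b+1)/2} n^{2a+b} α^{n+2-a-b}
--   = (1/2)^a (1/√5)^{a+b+1} n^{2a+b} α^{n+2} (α⁻¹)^{a+b}
mainTerm : ℕ → ℕ → ℕ → Q5
mainTerm a b n =
  (fromℚ ½ ^₅ a) *₅ (√5⁻¹ ^₅ (a ℕ.+ b ℕ.+ 1)) *₅ (fromℕ n ^₅ (2 ℕ.* a ℕ.+ b))
    *₅ (α ^₅ (n ℕ.+ 2)) *₅ (α⁻¹ ^₅ (a ℕ.+ b))

-- error scale n^{2a+b-1} α^n = n^{2a+b} · n⁻¹ · α^n, for n = suc m ≥ 1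
errScale : ℕ → ℕ → ℕ → Q5
errScale a b m =
  (fromℕ (suc m) ^₅ (2 ℕ.* a ℕ.+ b)) *₅ fromℚ (+ 1 / suc m) *₅ (α ^₅ suc m)

{-# OPTIONS --safe #-}
module Submission where

-- Splitting the admissible subsets of {1,…,n+2} by whether they contain n+2 and expanding
-- (σ + n + 2)^a (|I| + 1)^b gives G_{a,b}(n+2) = G_{a,b}(n+1) + G_{a,b}(n) + h(n), where the
-- dominant part of h is a n G_{a-1,b}(n) + b G_{a,b-1}(n). Hence, by induction,
-- G_{a,b}(n) = P(n) αⁿ + Q(n) βⁿ with β the conjugate of α and P, Q polynomials of degree at
-- most 2a+b, and the recurrence determines the leading coefficient of P. Multiplied by αⁿ,
-- the error is a combination of α²ⁿ and (βα)ⁿ = (−1)ⁿ with polynomial coefficients, and such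
-- a combination can be estimated coordinatewise in the basis 1, √5.

open import Defs
open import Data.Nat using (ℕ; suc; _≤_)
open import Data.Product using (Σ)
open import Level using (0ℓ)
open import Algebra.Bundles using (CommutativeRing)
open import Algebra.Consequences.Propositional using (comm∧idˡ⇒id; comm∧invˡ⇒inv; comm∧distrˡ⇒distrʳ)
open import Data.Bool using (Bool; true; false; not; _∧_; _∨_; if_then_else_)
import Data.Bool.Properties as Bool
open import Data.Integer using (+_; -[1+_])
import Data.Integer as ℤ
import Data.Integer.Properties as ℤ
open import Data.List using (List; []; _∷_; _∷ʳ_; map; _++_; filter; length; upTo; foldr)
import Data.List.Properties as List
open import Data.List.Relation.Unary.All as All using (All; []; _∷_)
import Data.List.Relation.Unary.All.Properties as All
open import Data.Maybe using (Maybe; just; nothing)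
open import Data.Nat as ℕ using (zero; _+_; _*_; _^_; _<_; s≤s)
import Data.Nat.Properties as ℕ
open import Data.Nat.ListAction using (sum)
open import Data.Nat.ListAction.Properties using (sum-++)
open import Data.Nat.Tactic.RingSolver using () renaming (solve-∀ to solve-∀-ℕ)
open import Data.Product using (_×_; _,_; proj₁; proj₂)
open import Data.Rational as ℚ using (ℚ; mkℚ; 0ℚ; 1ℚ; ½; _/_)
import Data.Rational.Properties as ℚ
import Data.Rational.Unnormalised as ℚᵘ
import Data.Rational.Unnormalised.Properties as ℚᵘ
open import Data.Sum using (inj₁; inj₂)
open import Relation.Binary.PropositionalEquality
open import Relation.Nullary using (yes; no; contradiction)
open import Relation.Nullary.Decidable using (⌊_⌋; dec⇒maybe)
open import Tactic.RingSolver using (solve-∀)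
open import Tactic.RingSolver.Core.AlmostCommutativeRing using (AlmostCommutativeRing; fromCommutativeRing)

-- The field ℚ(√5)

-- Why multiply the error by αⁿ? The real sign of x + y√5 takes a case split, whereas coordinatewise
-- nonnegativity is visibly stable under sums and products, but it is stricter. Under it βⁿ counts
-- as being as large as αⁿ, since their coordinates agree up to sign. As Q may have the full degree
-- 2a+b, the term Q(n) βⁿ would then exceed the error scale by a factor n. After multiplication by
-- αⁿ the conjugate term is ±Q(n), while the scale carries α²ⁿ, and a spare αⁿ absorbs the excess n.
-- Dividing by αⁿ at the end preserves the real sign.
--
-- The forcing term h grows with the characteristic roots α and β themselves. This resonance raises
-- the degree by one and divides the top coefficient by (2a+b)(α+2). Initial values enter only
-- through a Fibonacci sequence, whose coefficients are constants, so they affect the leading term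
-- only for a = b = 0.

ℚ-ring : AlmostCommutativeRing 0ℓ 0ℓ
ℚ-ring = fromCommutativeRing ℚ.+-*-commutativeRing (λ x → dec⇒maybe (0ℚ ℚ.≟ x))

Q5-≡ : ∀ {u v : Q5} → re u ≡ re v → im u ≡ im v → u ≡ v
Q5-≡ refl refl = refl

0₅ 1₅ : Q5
0₅ = fromℚ 0ℚ
1₅ = fromℚ 1ℚ

5ℚ : ℚ
5ℚ = + 5 / 1

*₅-comm : ∀ u v → u *₅ v ≡ v *₅ u
*₅-comm u v = Q5-≡ (reEq (re u) (im u) (re v) (im v) 5ℚ) (imEq (re u) (im u) (re v) (im v))
  where
  reEq : ∀ a b c d k → a ℚ.* c ℚ.+ k ℚ.* (b ℚ.* d) ≡ c ℚ.* a ℚ.+ k ℚ.* (d ℚ.* b)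
  reEq = solve-∀ ℚ-ring
  imEq : ∀ a b c d → a ℚ.* d ℚ.+ b ℚ.* c ≡ c ℚ.* b ℚ.+ d ℚ.* a
  imEq = solve-∀ ℚ-ring

*₅-assoc : ∀ u v w → (u *₅ v) *₅ w ≡ u *₅ (v *₅ w)
*₅-assoc u v w = Q5-≡ (reEq (re u) (im u) (re v) (im v) (re w) (im w) 5ℚ) (imEq (re u) (im u) (re v) (im v) (re w) (im w) 5ℚ)
  where
  reEq : ∀ a b c d e f k →
    (a ℚ.* c ℚ.+ k ℚ.* (b ℚ.* d)) ℚ.* e ℚ.+ k ℚ.* ((a ℚ.* d ℚ.+ b ℚ.* c) ℚ.* f)
    ≡ a ℚ.* (c ℚ.* e ℚ.+ k ℚ.* (d ℚ.* f)) ℚ.+ k ℚ.* (b ℚ.* (c ℚ.* f ℚ.+ d ℚ.* e))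
  reEq = solve-∀ ℚ-ring
  imEq : ∀ a b c d e f k →
    (a ℚ.* c ℚ.+ k ℚ.* (b ℚ.* d)) ℚ.* f ℚ.+ (a ℚ.* d ℚ.+ b ℚ.* c) ℚ.* e
    ≡ a ℚ.* (c ℚ.* f ℚ.+ d ℚ.* e) ℚ.+ b ℚ.* (c ℚ.* e ℚ.+ k ℚ.* (d ℚ.* f))
  imEq = solve-∀ ℚ-ring

*₅-identityˡ : ∀ u → 1₅ *₅ u ≡ u
*₅-identityˡ u = Q5-≡ (reEq (re u) (im u) 5ℚ) (imEq (re u) (im u))
  where
  reEq : ∀ a b k → 1ℚ ℚ.* a ℚ.+ k ℚ.* (0ℚ ℚ.* b) ≡ a
  reEq = solve-∀ ℚ-ring
  imEq : ∀ a b → 1ℚ ℚ.* b ℚ.+ 0ℚ ℚ.* a ≡ b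
  imEq = solve-∀ ℚ-ring

*₅-distribˡ-+₅ : ∀ u v w → u *₅ (v +₅ w) ≡ u *₅ v +₅ u *₅ w
*₅-distribˡ-+₅ u v w = Q5-≡ (reEq (re u) (im u) (re v) (im v) (re w) (im w) 5ℚ) (imEq (re u) (im u) (re v) (im v) (re w) (im w))
  where
  reEq : ∀ a b c d e f k →
    a ℚ.* (c ℚ.+ e) ℚ.+ k ℚ.* (b ℚ.* (d ℚ.+ f))
    ≡ (a ℚ.* c ℚ.+ k ℚ.* (b ℚ.* d)) ℚ.+ (a ℚ.* e ℚ.+ k ℚ.* (b ℚ.* f))
  reEq = solve-∀ ℚ-ring
  imEq : ∀ a b c d e f →
    a ℚ.* (d ℚ.+ f) ℚ.+ b ℚ.* (c ℚ.+ e) ≡ (a ℚ.* d ℚ.+ b ℚ.* c) ℚ.+ (a ℚ.* f ℚ.+ b ℚ.* e)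
  imEq = solve-∀ ℚ-ring

Q5-commutativeRing : CommutativeRing 0ℓ 0ℓ
Q5-commutativeRing = record
  { Carrier = Q5 ; _≈_ = _≡_ ; _+_ = _+₅_ ; _*_ = _*₅_ ; -_ = -₅_ ; 0# = 0₅ ; 1# = 1₅
  ; isCommutativeRing = record
    { isRing = record
      { +-isAbelianGroup = record
        { isGroup = record
          { isMonoid = record
            { isSemigroup = record
              { isMagma = record { isEquivalence = isEquivalence ; ∙-cong = cong₂ _+₅_ }
              ; assoc = λ u v w → Q5-≡ (ℚ.+-assoc (re u) (re v) (re w)) (ℚ.+-assoc (im u) (im v) (im w)) }
            ; identity = comm∧idˡ⇒id +₅-comm (λ u → Q5-≡ (ℚ.+-identityˡ (re u)) (ℚ.+-identityˡ (im u))) }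
          ; inverse = comm∧invˡ⇒inv +₅-comm (λ u → Q5-≡ (ℚ.+-inverseˡ (re u)) (ℚ.+-inverseˡ (im u)))
          ; ⁻¹-cong = cong (λ u → -₅ u) }
        ; comm = +₅-comm }
      ; *-cong = cong₂ _*₅_
      ; *-assoc = *₅-assoc
      ; *-identity = comm∧idˡ⇒id *₅-comm *₅-identityˡ
      ; distrib = *₅-distribˡ-+₅ , comm∧distrˡ⇒distrʳ *₅-comm *₅-distribˡ-+₅ }
    ; *-comm = *₅-comm } }
  where
  +₅-comm : ∀ u v → u +₅ v ≡ v +₅ u
  +₅-comm u v = Q5-≡ (ℚ.+-comm (re u) (re v)) (ℚ.+-comm (im u) (im v))

Q5-ring : AlmostCommutativeRing 0ℓ 0ℓ
Q5-ring = fromCommutativeRing Q5-commutativeRing 0₅≟_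
  where
  0₅≟_ : ∀ u → Maybe (0₅ ≡ u)
  0₅≟ ⟨ a , b ⟩ with 0ℚ ℚ.≟ a | 0ℚ ℚ.≟ b
  ... | yes p | yes q = just (Q5-≡ p q)
  ... | _     | _     = nothing

open CommutativeRing Q5-commutativeRing public
  using () renaming (+-identityˡ to +₅-identityˡ; +-identityʳ to +₅-identityʳ; zeroˡ to zeroˡ₅; zeroʳ to zeroʳ₅)

/1-suc : ∀ n → (+ suc n) / 1 ≡ 1ℚ ℚ.+ (+ n) / 1
/1-suc n = ℚ.toℚᵘ-injective (begin
  ℚ.toℚᵘ ((+ suc n) / 1)                 ≈⟨ ℚ.toℚᵘ-fromℚᵘ (ℚᵘ.mkℚᵘ (+ suc n) 0) ⟩
  ℚᵘ.mkℚᵘ (+ suc n) 0                    ≈⟨ ℚᵘ.*≡* (cong (λ k → (+ 1 ℤ.+ k) ℤ.* + 1) (sym (ℤ.*-identityʳ (+ n)))) ⟩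
  ℚᵘ.1ℚᵘ ℚᵘ.+ ℚᵘ.mkℚᵘ (+ n) 0            ≈⟨ ℚᵘ.+-congʳ ℚᵘ.1ℚᵘ (ℚᵘ.≃-sym (ℚ.toℚᵘ-fromℚᵘ (ℚᵘ.mkℚᵘ (+ n) 0))) ⟩
  ℚ.toℚᵘ 1ℚ ℚᵘ.+ ℚ.toℚᵘ ((+ n) / 1)      ≈⟨ ℚᵘ.≃-sym (ℚ.toℚᵘ-homo-+ 1ℚ ((+ n) / 1)) ⟩
  ℚ.toℚᵘ (1ℚ ℚ.+ (+ n) / 1)              ∎)
  where open ℚᵘ.≃-Reasoning

-- Opaque, because unfolding fromℕ on open terms exposes the gcd normalisation of _/_.
opaque
  ι : ℕ → Q5
  ι = fromℕ

  ι≡fromℕ : ∀ n → ι n ≡ fromℕ n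
  ι≡fromℕ n = refl

  ι-zero : ι 0 ≡ 0₅
  ι-zero = refl

  ι-suc : ∀ n → ι (suc n) ≡ ι n +₅ 1₅
  ι-suc n = Q5-≡ (trans (/1-suc n) (ℚ.+-comm 1ℚ (+ n / 1))) refl

ι-+ : ∀ m n → ι (m ℕ.+ n) ≡ ι m +₅ ι n
ι-+ zero    n = sym (trans (cong (_+₅ ι n) ι-zero) (+₅-identityˡ (ι n)))
ι-+ (suc m) n = begin
  ι (suc m ℕ.+ n)       ≡⟨ ι-suc (m ℕ.+ n) ⟩
  ι (m ℕ.+ n) +₅ 1₅     ≡⟨ cong (_+₅ 1₅) (ι-+ m n) ⟩
  ι m +₅ ι n +₅ 1₅      ≡⟨ lem (ι m) (ι n) ⟩
  ι m +₅ 1₅ +₅ ι n      ≡⟨ cong (_+₅ ι n) (sym (ι-suc m)) ⟩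
  ι (suc m) +₅ ι n      ∎
  where
  open ≡-Reasoning
  lem : ∀ x y → x +₅ y +₅ 1₅ ≡ x +₅ 1₅ +₅ y
  lem = solve-∀ Q5-ring

ι-* : ∀ m n → ι (m ℕ.* n) ≡ ι m *₅ ι n
ι-* zero    n = trans ι-zero (sym (trans (cong (_*₅ ι n) ι-zero) (zeroˡ₅ (ι n))))
ι-* (suc m) n = begin
  ι (n ℕ.+ m ℕ.* n)       ≡⟨ ι-+ n (m ℕ.* n) ⟩
  ι n +₅ ι (m ℕ.* n)      ≡⟨ cong (ι n +₅_) (ι-* m n) ⟩
  ι n +₅ ι m *₅ ι n       ≡⟨ lem (ι m) (ι n) ⟩
  (ι m +₅ 1₅) *₅ ι n      ≡⟨ cong (_*₅ ι n) (sym (ι-suc m)) ⟩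
  ι (suc m) *₅ ι n        ∎
  where
  open ≡-Reasoning
  lem : ∀ x y → y +₅ x *₅ y ≡ (x +₅ 1₅) *₅ y
  lem = solve-∀ Q5-ring

-- Polynomials in n

-- f is a polynomial function of degree below d whose coefficient at n^(d-1) is c; for d = 0 this forces c = 0.
data Poly : ℕ → Q5 → (ℕ → Q5) → Set where
  vanishing : ∀ {c f} → c ≡ 0₅ → (∀ n → f n ≡ 0₅) → Poly zero c f
  leading   : ∀ {d c c′ f} g → Poly d c′ g → (∀ n → f n ≡ c *₅ (ι n ^₅ d) +₅ g n) → Poly (suc d) c f

Poly-cong : ∀ {d c c′ f g} → c ≡ c′ → (∀ n → f n ≡ g n) → Poly d c f → Poly d c′ g
Poly-cong c≡c′ f≗g (vanishing c≡0 f≡0) = vanishing (trans (sym c≡c′) c≡0) λ n → trans (sym (f≗g n)) (f≡0 n)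
Poly-cong {suc d} c≡c′ f≗g (leading f₁ Pf f≡) =
  leading f₁ Pf λ n → trans (sym (f≗g n)) (trans (f≡ n) (cong (λ c → c *₅ (ι n ^₅ d) +₅ f₁ n) c≡c′))

Poly-0 : ∀ d → Poly d 0₅ (λ _ → 0₅)
Poly-0 zero    = vanishing refl λ _ → refl
Poly-0 (suc d) = leading (λ _ → 0₅) (Poly-0 d) λ n → lem (ι n ^₅ d)
  where
  lem : ∀ x → 0₅ ≡ 0₅ *₅ x +₅ 0₅
  lem = solve-∀ Q5-ring

Poly-+ : ∀ {d c c′ f g} → Poly d c f → Poly d c′ g → Poly d (c +₅ c′) (λ n → f n +₅ g n)
Poly-+ (vanishing c≡0 f≡0) (vanishing c′≡0 g≡0) =
  vanishing (cong₂ _+₅_ c≡0 c′≡0) λ n → cong₂ _+₅_ (f≡0 n) (g≡0 n)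
Poly-+ {suc d} {c} {c′} (leading f₁ Pf f≡) (leading g₁ Pg g≡) =
  leading (λ n → f₁ n +₅ g₁ n) (Poly-+ Pf Pg) λ n → trans (cong₂ _+₅_ (f≡ n) (g≡ n)) (lem c c′ (ι n ^₅ d) (f₁ n) (g₁ n))
  where
  lem : ∀ c c′ x u v → (c *₅ x +₅ u) +₅ (c′ *₅ x +₅ v) ≡ (c +₅ c′) *₅ x +₅ (u +₅ v)
  lem = solve-∀ Q5-ring

Poly-scale : ∀ {d c f} k → Poly d c f → Poly d (k *₅ c) (λ n → k *₅ f n)
Poly-scale k (vanishing c≡0 f≡0) =
  vanishing (trans (cong (k *₅_) c≡0) (zeroʳ₅ k)) λ n → trans (cong (k *₅_) (f≡0 n)) (zeroʳ₅ k)
Poly-scale {suc d} {c} k (leading f₁ Pf f≡) =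
  leading (λ n → k *₅ f₁ n) (Poly-scale k Pf) λ n → trans (cong (k *₅_) (f≡ n)) (lem k c (ι n ^₅ d) (f₁ n))
  where
  lem : ∀ k c x u → k *₅ (c *₅ x +₅ u) ≡ k *₅ c *₅ x +₅ k *₅ u
  lem = solve-∀ Q5-ring

Poly-weaken : ∀ {d c f} → Poly d c f → Poly (suc d) 0₅ f
Poly-weaken {d} {c} {f} Pf = leading f Pf λ n → lem (ι n ^₅ d) (f n)
  where
  lem : ∀ x u → u ≡ 0₅ *₅ x +₅ u
  lem = solve-∀ Q5-ring

Poly-n* : ∀ {d c f} → Poly d c f → Poly (suc d) c (λ n → ι n *₅ f n)
Poly-n* (vanishing refl f≡0) =
  leading (λ _ → 0₅) (Poly-0 0) λ n → trans (cong (ι n *₅_) (f≡0 n)) (zeroʳ₅ (ι n))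
Poly-n* {suc d} {c} (leading f₁ Pf f≡) =
  leading (λ n → ι n *₅ f₁ n) (Poly-n* Pf) λ n → trans (cong (ι n *₅_) (f≡ n)) (lem (ι n) c (ι n ^₅ d) (f₁ n))
  where
  lem : ∀ m c x u → m *₅ (c *₅ x +₅ u) ≡ c *₅ (m *₅ x) +₅ m *₅ u
  lem = solve-∀ Q5-ring

Poly-const : ∀ c → Poly 1 c (λ _ → c)
Poly-const c = leading (λ _ → 0₅) (Poly-0 0) λ _ → lem c
  where
  lem : ∀ c → c ≡ c *₅ 1₅ +₅ 0₅
  lem = solve-∀ Q5-ring

Poly-shifted-power : ∀ ρ k → Poly (suc k) 1₅ (λ n → (ι n +₅ ρ) ^₅ k)
Poly-shifted-power ρ zero    = Poly-const 1₅
Poly-shifted-power ρ (suc k) =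
  Poly-cong refl (λ n → lem (ι n) ρ ((ι n +₅ ρ) ^₅ k))
    (Poly-+ (Poly-n* IH) (Poly-weaken (Poly-scale ρ IH)))
  where
  IH = Poly-shifted-power ρ k
  lem : ∀ m ρ x → m *₅ x +₅ ρ *₅ x ≡ (m +₅ ρ) *₅ x
  lem = solve-∀ Q5-ring

-- Cancelling n^k leaves the binomial term kρ n^(k-1) on top. The induction rests on (n + ρ)x - ny =
-- n(x - y) + ρx.
Poly-power-difference : ∀ ρ k →
  Poly k (ι k *₅ ρ) (λ n → (ι n +₅ ρ) ^₅ k -₅ ι n ^₅ k)
Poly-power-difference ρ zero    = vanishing (trans (cong (_*₅ ρ) ι-zero) (zeroˡ₅ ρ)) λ _ → refl
Poly-power-difference ρ (suc k) =
  Poly-cong (trans (lem₁ (ι k) ρ) (cong (_*₅ ρ) (sym (ι-suc k))))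
    (λ n → lem₂ (ι n) ρ ((ι n +₅ ρ) ^₅ k) (ι n ^₅ k))
    (Poly-+ (Poly-n* (Poly-power-difference ρ k))
            (Poly-scale ρ (Poly-shifted-power ρ k)))
  where
  lem₁ : ∀ m ρ → m *₅ ρ +₅ ρ *₅ 1₅ ≡ (m +₅ 1₅) *₅ ρ
  lem₁ = solve-∀ Q5-ring
  lem₂ : ∀ m ρ x y → m *₅ (x -₅ y) +₅ ρ *₅ x ≡ (m +₅ ρ) *₅ x -₅ m *₅ y
  lem₂ = solve-∀ Q5-ring

-- Brings a coefficient into the shape that `Poly-recurrence` expects. At d = 0 the factor `ι d` is
-- 0 and cannot be inverted, but there the polynomial itself forces c = 0.
Poly-leading-div : ∀ {κ} → (∀ e → Σ Q5 λ κ⁻¹ → ι (suc e) *₅ κ *₅ κ⁻¹ ≡ 1₅) →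
  ∀ d {c f} → Poly d c f → Σ Q5 λ c′ → c ≡ ι d *₅ κ *₅ c′
Poly-leading-div {κ} inv zero (vanishing c≡0 _) = 0₅ , trans c≡0 (sym (zeroʳ₅ (ι 0 *₅ κ)))
Poly-leading-div {κ} inv (suc e) {c} _ with inv e
... | κ⁻¹ , eq = κ⁻¹ *₅ c , trans (sym (*₅-identityˡ c)) (trans (cong (_*₅ c) (sym eq)) (*₅-assoc (ι (suc e) *₅ κ) κ⁻¹ c))

-- Inserting f n = P n rⁿ with r² = r + 1 into f (n+2) = f (n+1) + f n + H n rⁿ leaves the recurrence below.
-- Its left minus right side maps n^d to d(2r² − r) n^(d−1) + …, and 2r² − r = r + 2.
Poly-recurrence : ∀ {r} → r *₅ r ≡ r +₅ 1₅ →
  (∀ e → Σ Q5 λ κ⁻¹ → ι (suc e) *₅ (r +₅ 1₅ +₅ 1₅) *₅ κ⁻¹ ≡ 1₅) →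
  ∀ d {c H} → Poly d (ι d *₅ (r +₅ 1₅ +₅ 1₅) *₅ c) H →
  Σ (ℕ → Q5) λ P → Poly (suc d) c P ×
    (∀ n → (r *₅ r) *₅ P (suc (suc n)) ≡ r *₅ P (suc n) +₅ P n +₅ H n)
-- Without forcing, every constant solves the recurrence because r² = r + 1, so c can be prescribed
-- freely.
Poly-recurrence {r} r² inv zero {c} {H} (vanishing _ H≡0) = (λ _ → c) , Poly-const c , λ n → begin
  (r *₅ r) *₅ c             ≡⟨ cong (_*₅ c) r² ⟩
  (r +₅ 1₅) *₅ c            ≡⟨ lem r c ⟩
  r *₅ c +₅ c +₅ 0₅         ≡⟨ cong (r *₅ c +₅ c +₅_) (sym (H≡0 n)) ⟩
  r *₅ c +₅ c +₅ H n        ∎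
  where
  open ≡-Reasoning
  lem : ∀ r c → (r +₅ 1₅) *₅ c ≡ r *₅ c +₅ c +₅ 0₅
  lem = solve-∀ Q5-ring
Poly-recurrence {r} r² inv (suc e) {c} {H} (leading H₁ PH₁ H≡) = solve-remainder PR
  where
  open ≡-Reasoning
  k = suc e
  X : Q5 → ℕ → Q5
  X ρ n = (ι n +₅ ρ) ^₅ k
  -- The defect of c n^k in the recurrence. Since (r + 1) - r = 1, the term -n^k can be shared out
  -- between the two differences, each of degree below k.
  R : ℕ → Q5
  R n = c *₅ ((r +₅ 1₅) *₅ (X (1₅ +₅ 1₅) n -₅ ι n ^₅ k) -₅ r *₅ (X 1₅ n -₅ ι n ^₅ k))
  PR : Poly k (ι k *₅ (r +₅ 1₅ +₅ 1₅) *₅ c) R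
  PR = Poly-cong (lem₁ (ι k) r c)
    (λ n → lem₂ c r (X (1₅ +₅ 1₅) n) (X 1₅ n) (ι n ^₅ k))
    (Poly-scale c (Poly-+ (Poly-scale (r +₅ 1₅) (Poly-power-difference (1₅ +₅ 1₅) k))
                          (Poly-scale (-₅ r) (Poly-power-difference 1₅ k))))
    where
    lem₁ : ∀ m r c → c *₅ ((r +₅ 1₅) *₅ (m *₅ (1₅ +₅ 1₅)) +₅ (-₅ r) *₅ (m *₅ 1₅)) ≡ m *₅ (r +₅ 1₅ +₅ 1₅) *₅ c
    lem₁ = solve-∀ Q5-ring
    lem₂ : ∀ c r x y z → c *₅ ((r +₅ 1₅) *₅ (x -₅ z) +₅ (-₅ r) *₅ (y -₅ z)) ≡ c *₅ ((r +₅ 1₅) *₅ (x -₅ z) -₅ r *₅ (y -₅ z))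
    lem₂ = solve-∀ Q5-ring
  ι-suc² : ∀ n → ι (suc (suc n)) ≡ ι n +₅ (1₅ +₅ 1₅)
  ι-suc² n = trans (ι-suc (suc n)) (trans (cong (_+₅ 1₅) (ι-suc n)) (lem (ι n)))
    where
    lem : ∀ x → x +₅ 1₅ +₅ 1₅ ≡ x +₅ (1₅ +₅ 1₅)
    lem = solve-∀ Q5-ring
  recurrence : ∀ P₁ →
    (∀ n → (r *₅ r) *₅ P₁ (suc (suc n)) ≡ r *₅ P₁ (suc n) +₅ P₁ n +₅ (H n -₅ R n)) →
    let P = λ n → c *₅ (ι n ^₅ k) +₅ P₁ n in
    ∀ n → (r *₅ r) *₅ P (suc (suc n)) ≡ r *₅ P (suc n) +₅ P n +₅ H n
  recurrence P₁ P₁-rec n = begin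
    (r *₅ r) *₅ (c *₅ (ι (suc (suc n)) ^₅ k) +₅ P₁ (suc (suc n)))
      ≡⟨ lem₁ (r *₅ r) c (ι (suc (suc n)) ^₅ k) (P₁ (suc (suc n))) ⟩
    (r *₅ r) *₅ (c *₅ (ι (suc (suc n)) ^₅ k)) +₅ (r *₅ r) *₅ P₁ (suc (suc n))
      ≡⟨ cong₂ _+₅_ (cong₂ (λ q x → q *₅ (c *₅ (x ^₅ k))) r² (ι-suc² n)) (P₁-rec n) ⟩
    (r +₅ 1₅) *₅ (c *₅ X (1₅ +₅ 1₅) n) +₅ (r *₅ P₁ (suc n) +₅ P₁ n +₅ (H n -₅ R n))
      ≡⟨ lem₂ r c (X (1₅ +₅ 1₅) n) (X 1₅ n) (ι n ^₅ k) (P₁ (suc n)) (P₁ n) (H n) ⟩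
    r *₅ (c *₅ X 1₅ n +₅ P₁ (suc n)) +₅ (c *₅ (ι n ^₅ k) +₅ P₁ n) +₅ H n
      ≡⟨ cong (λ x → r *₅ (c *₅ (x ^₅ k) +₅ P₁ (suc n)) +₅ (c *₅ (ι n ^₅ k) +₅ P₁ n) +₅ H n) (sym (ι-suc n)) ⟩
    r *₅ (c *₅ (ι (suc n) ^₅ k) +₅ P₁ (suc n)) +₅ (c *₅ (ι n ^₅ k) +₅ P₁ n) +₅ H n ∎
    where
    lem₁ : ∀ q c x p → q *₅ (c *₅ x +₅ p) ≡ q *₅ (c *₅ x) +₅ q *₅ p
    lem₁ = solve-∀ Q5-ring
    lem₂ : ∀ r c x y z p q h →
      (r +₅ 1₅) *₅ (c *₅ x) +₅ (r *₅ p +₅ q +₅ (h -₅ c *₅ ((r +₅ 1₅) *₅ (x -₅ z) -₅ r *₅ (y -₅ z))))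
      ≡ r *₅ (c *₅ y +₅ p) +₅ (c *₅ z +₅ q) +₅ h
    lem₂ = solve-∀ Q5-ring
  solve-remainder : Poly k (ι k *₅ (r +₅ 1₅ +₅ 1₅) *₅ c) R → Σ (ℕ → Q5) λ P → Poly (suc k) c P ×
    (∀ n → (r *₅ r) *₅ P (suc (suc n)) ≡ r *₅ P (suc n) +₅ P n +₅ H n)
  solve-remainder (leading R₁ PR₁ R≡) = _ , leading P₁ PolyP₁ (λ _ → refl) , recurrence P₁ P₁-rec
    where
    H₁-R₁≡H-R : ∀ n → H₁ n +₅ (-₅ 1₅) *₅ R₁ n ≡ H n -₅ R n
    H₁-R₁≡H-R n = sym (trans (cong₂ _-₅_ (H≡ n) (R≡ n)) (lem (ι k *₅ (r +₅ 1₅ +₅ 1₅) *₅ c *₅ ι n ^₅ e) (H₁ n) (R₁ n)))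
      where
      lem : ∀ x h r → (x +₅ h) -₅ (x +₅ r) ≡ h +₅ (-₅ 1₅) *₅ r
      lem = solve-∀ Q5-ring
    -- H and R have the same coefficient at n^e, so their difference drops a degree and the
    -- recursion on e applies to it.
    remainder = Poly-cong refl H₁-R₁≡H-R (Poly-+ PH₁ (Poly-scale (-₅ 1₅) PR₁))
    quotient = Poly-leading-div {r +₅ 1₅ +₅ 1₅} inv e remainder
    solution = Poly-recurrence {r} r² inv e (Poly-cong (proj₂ quotient) (λ _ → refl) remainder)
    P₁ = proj₁ solution
    PolyP₁ = proj₁ (proj₂ solution)
    P₁-rec = proj₂ (proj₂ solution)

-- Exponential polynomials

β : Q5
β = ⟨ ½ , ℚ.- ½ ⟩

ι-inverse : ∀ n → ι (suc n) *₅ fromℚ (+ 1 / suc n) ≡ 1₅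
ι-inverse n = trans (cong (_*₅ fromℚ (+ 1 / suc n)) (ι≡fromℕ (suc n)))
  (Q5-≡ (trans (lem₁ (+ suc n / 1) (+ 1 / suc n) 5ℚ) (ℚ.toℚᵘ-injective (begin
    ℚ.toℚᵘ (+ suc n / 1 ℚ.* (+ 1 / suc n))                    ≈⟨ ℚ.toℚᵘ-homo-* (+ suc n / 1) (+ 1 / suc n) ⟩
    ℚ.toℚᵘ (+ suc n / 1) ℚᵘ.* ℚ.toℚᵘ (+ 1 / suc n)            ≈⟨ ℚᵘ.*-cong (ℚ.toℚᵘ-fromℚᵘ (ℚᵘ.mkℚᵘ (+ suc n) 0)) (ℚ.toℚᵘ-fromℚᵘ (ℚᵘ.mkℚᵘ (+ 1) n)) ⟩
    ℚᵘ.mkℚᵘ (+ suc n) 0 ℚᵘ.* ℚᵘ.mkℚᵘ (+ 1) n                  ≈⟨ ℚᵘ.*≡* (ℤ.*-assoc (+ suc n) (+ 1) (+ suc n)) ⟩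
    ℚᵘ.mkℚᵘ (+ suc n) n                                       ≈⟨ ℚᵘ.*≡* (ℤ.*-comm (+ suc n) (+ 1)) ⟩
    ℚᵘ.1ℚᵘ                                                    ∎))) (lem₂ (+ suc n / 1) (+ 1 / suc n)))
  where
  open ℚᵘ.≃-Reasoning
  lem₁ : ∀ x y k → x ℚ.* y ℚ.+ k ℚ.* (0ℚ ℚ.* 0ℚ) ≡ x ℚ.* y
  lem₁ = solve-∀ ℚ-ring
  lem₂ : ∀ x y → x ℚ.* 0ℚ ℚ.+ 0ℚ ℚ.* y ≡ 0ℚ
  lem₂ = solve-∀ ℚ-ring

-- α + 2 = √5 α and β + 2 = −√5 β.
α+2-invertible : ∀ e → Σ Q5 λ κ⁻¹ → ι (suc e) *₅ (α +₅ 1₅ +₅ 1₅) *₅ κ⁻¹ ≡ 1₅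
α+2-invertible e = fromℚ (+ 1 / suc e) *₅ (√5⁻¹ *₅ α⁻¹) ,
  trans (lem (ι (suc e)) (fromℚ (+ 1 / suc e))) (ι-inverse e)
  where
  lem : ∀ x y → x *₅ (α +₅ 1₅ +₅ 1₅) *₅ (y *₅ (√5⁻¹ *₅ α⁻¹)) ≡ x *₅ y
  lem = solve-∀ Q5-ring

β+2-invertible : ∀ e → Σ Q5 λ κ⁻¹ → ι (suc e) *₅ (β +₅ 1₅ +₅ 1₅) *₅ κ⁻¹ ≡ 1₅
-- As β⁻¹ = -α, the two signs cancel: (-√5 β)⁻¹ = α/√5.
β+2-invertible e = fromℚ (+ 1 / suc e) *₅ (√5⁻¹ *₅ α) ,
  trans (lem (ι (suc e)) (fromℚ (+ 1 / suc e))) (ι-inverse e)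
  where
  lem : ∀ x y → x *₅ (β +₅ 1₅ +₅ 1₅) *₅ (y *₅ (√5⁻¹ *₅ α)) ≡ x *₅ y
  lem = solve-∀ Q5-ring

-- Binet's formula for arbitrary initial values: the coefficients solve p + q = f 0 and pα + qβ = f
-- 1, where α - β = √5.
fibonacci-closed-form : ∀ (f : ℕ → Q5) → (∀ n → f (suc (suc n)) ≡ f (suc n) +₅ f n) → ∀ n →
  f n ≡ √5⁻¹ *₅ (f 1 -₅ β *₅ f 0) *₅ (α ^₅ n) +₅ √5⁻¹ *₅ (α *₅ f 0 -₅ f 1) *₅ (β ^₅ n)
fibonacci-closed-form f rec n = proj₁ (both n)
  where
  open ≡-Reasoning
  p = √5⁻¹ *₅ (f 1 -₅ β *₅ f 0)
  q = √5⁻¹ *₅ (α *₅ f 0 -₅ f 1)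
  closed : ℕ → Q5
  closed n = p *₅ (α ^₅ n) +₅ q *₅ (β ^₅ n)
  both : ∀ n → f n ≡ closed n × f (suc n) ≡ closed (suc n)
  both zero = lem₀ (f 0) (f 1) , lem₁ (f 0) (f 1)
    where
    lem₀ : ∀ x y → x ≡ √5⁻¹ *₅ (y -₅ β *₅ x) *₅ 1₅ +₅ √5⁻¹ *₅ (α *₅ x -₅ y) *₅ 1₅
    lem₀ = solve-∀ Q5-ring
    lem₁ : ∀ x y → y ≡ √5⁻¹ *₅ (y -₅ β *₅ x) *₅ (α *₅ 1₅) +₅ √5⁻¹ *₅ (α *₅ x -₅ y) *₅ (β *₅ 1₅)
    lem₁ = solve-∀ Q5-ring
  both (suc n) = proj₂ (both n) , (begin
    f (suc (suc n))              ≡⟨ rec n ⟩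
    f (suc n) +₅ f n             ≡⟨ cong₂ _+₅_ (proj₂ (both n)) (proj₁ (both n)) ⟩
    closed (suc n) +₅ closed n   ≡⟨ lem p q (α ^₅ n) (β ^₅ n) ⟩
    closed (suc (suc n))         ∎)
    where
    lem : ∀ p q x y → (p *₅ (α *₅ x) +₅ q *₅ (β *₅ y)) +₅ (p *₅ x +₅ q *₅ y) ≡ p *₅ (α *₅ (α *₅ x)) +₅ q *₅ (β *₅ (β *₅ y))
    lem = solve-∀ Q5-ring

-- c is the coefficient of n^(d-1) in P; the one in Q is not tracked.
record ExpPoly (d : ℕ) (c : Q5) (f : ℕ → Q5) : Set where
  constructor expPoly
  field
    {P Q}       : ℕ → Q5
    {c′}        : Q5
    poly-P      : Poly d c P
    poly-Q      : Poly d c′ Q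
    closed-form : ∀ n → f n ≡ P n *₅ (α ^₅ n) +₅ Q n *₅ (β ^₅ n)

ExpPoly-cong : ∀ {d c c₁ f g} → c ≡ c₁ → (∀ n → f n ≡ g n) → ExpPoly d c f → ExpPoly d c₁ g
ExpPoly-cong c≡ f≗g (expPoly PP PQ cf) =
  expPoly (Poly-cong c≡ (λ _ → refl) PP) PQ λ n → trans (sym (f≗g n)) (cf n)

ExpPoly-0 : ∀ d → ExpPoly d 0₅ (λ _ → 0₅)
ExpPoly-0 d = expPoly (Poly-0 d) (Poly-0 d) λ n → lem (α ^₅ n) (β ^₅ n)
  where
  lem : ∀ x y → 0₅ ≡ 0₅ *₅ x +₅ 0₅ *₅ y
  lem = solve-∀ Q5-ring

ExpPoly-+ : ∀ {d c c₁ f g} → ExpPoly d c f → ExpPoly d c₁ g → ExpPoly d (c +₅ c₁) (λ n → f n +₅ g n)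
ExpPoly-+ (expPoly {P} {Q} PP PQ cf) (expPoly {P₁} {Q₁} PP₁ PQ₁ cf₁) = expPoly (Poly-+ PP PP₁) (Poly-+ PQ PQ₁)
  λ n → trans (cong₂ _+₅_ (cf n) (cf₁ n)) (lem (P n) (Q n) (P₁ n) (Q₁ n) (α ^₅ n) (β ^₅ n))
  where
  lem : ∀ p q p₁ q₁ x y → (p *₅ x +₅ q *₅ y) +₅ (p₁ *₅ x +₅ q₁ *₅ y) ≡ (p +₅ p₁) *₅ x +₅ (q +₅ q₁) *₅ y
  lem = solve-∀ Q5-ring

ExpPoly-scale : ∀ {d c f} k → ExpPoly d c f → ExpPoly d (k *₅ c) (λ n → k *₅ f n)
ExpPoly-scale k (expPoly {P} {Q} PP PQ cf) = expPoly (Poly-scale k PP) (Poly-scale k PQ)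
  λ n → trans (cong (k *₅_) (cf n)) (lem k (P n) (Q n) (α ^₅ n) (β ^₅ n))
  where
  lem : ∀ k p q x y → k *₅ (p *₅ x +₅ q *₅ y) ≡ k *₅ p *₅ x +₅ k *₅ q *₅ y
  lem = solve-∀ Q5-ring

ExpPoly-weaken : ∀ {d c f} → ExpPoly d c f → ExpPoly (suc d) 0₅ f
ExpPoly-weaken (expPoly PP PQ cf) = expPoly (Poly-weaken PP) (Poly-weaken PQ) cf

ExpPoly-n* : ∀ {d c f} → ExpPoly d c f → ExpPoly (suc d) c (λ n → ι n *₅ f n)
ExpPoly-n* (expPoly {P} {Q} PP PQ cf) = expPoly (Poly-n* PP) (Poly-n* PQ)
  λ n → trans (cong (ι n *₅_) (cf n)) (lem (ι n) (P n) (Q n) (α ^₅ n) (β ^₅ n))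
  where
  lem : ∀ k p q x y → k *₅ (p *₅ x +₅ q *₅ y) ≡ k *₅ p *₅ x +₅ k *₅ q *₅ y
  lem = solve-∀ Q5-ring

ExpPoly-fibonacci : ∀ (f : ℕ → Q5) → (∀ n → f (suc (suc n)) ≡ f (suc n) +₅ f n) →
  ExpPoly 1 (√5⁻¹ *₅ (f 1 -₅ β *₅ f 0)) f
ExpPoly-fibonacci f rec = expPoly (Poly-const (√5⁻¹ *₅ (f 1 -₅ β *₅ f 0))) (Poly-const (√5⁻¹ *₅ (α *₅ f 0 -₅ f 1))) (fibonacci-closed-form f rec)

-- The particular solution given by Poly-recurrence at both roots α and β differs
-- from f by a Fibonacci sequence, which does not reach the leading term.
ExpPoly-recurrence : ∀ e {c} {f h : ℕ → Q5} → (∀ n → f (suc (suc n)) ≡ f (suc n) +₅ f n +₅ h n) →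
  ExpPoly (suc e) (ι (suc e) *₅ (α +₅ 1₅ +₅ 1₅) *₅ c) h → ExpPoly (suc (suc e)) c f
ExpPoly-recurrence e {c} {f} {h} rec (expPoly {PH} {QH} PolyPH PolyQH h≡) =
  ExpPoly-cong (+₅-identityʳ c) (λ n → cancel (u n) (f n))
    (ExpPoly-+ (expPoly PolyP PolyQ λ _ → refl)
      (raise e (ExpPoly-fibonacci (λ n → f n -₅ u n) difference-rec)))
  where
  open ≡-Reasoning
  -- The hypothesis on h already gives the α-part its required shape; the β-part has an unknown
  -- coefficient, which is obtained by division.
  quotient = Poly-leading-div {β +₅ 1₅ +₅ 1₅} β+2-invertible (suc e) PolyQH
  solutionP = Poly-recurrence {α} refl α+2-invertible (suc e) PolyPH
  solutionQ = Poly-recurrence {β} refl β+2-invertible (suc e)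
    (Poly-cong (proj₂ quotient) (λ _ → refl) PolyQH)
  P = proj₁ solutionP
  Q = proj₁ solutionQ
  PolyP = proj₁ (proj₂ solutionP)
  PolyQ = proj₁ (proj₂ solutionQ)
  u : ℕ → Q5
  u n = P n *₅ (α ^₅ n) +₅ Q n *₅ (β ^₅ n)
  cancel : ∀ x y → x +₅ (y -₅ x) ≡ y
  cancel = solve-∀ Q5-ring
  raise : ∀ e {c f} → ExpPoly 1 c f → ExpPoly (suc (suc e)) 0₅ f
  raise zero    E = ExpPoly-weaken E
  raise (suc e) E = ExpPoly-weaken (raise e E)
  u-rec : ∀ n → u (suc (suc n)) ≡ u (suc n) +₅ u n +₅ h n
  u-rec n = begin
    P (suc (suc n)) *₅ (α *₅ (α *₅ (α ^₅ n))) +₅ Q (suc (suc n)) *₅ (β *₅ (β *₅ (β ^₅ n)))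
      ≡⟨ lem₁ α β (P (suc (suc n))) (Q (suc (suc n))) (α ^₅ n) (β ^₅ n) ⟩
    ((α *₅ α) *₅ P (suc (suc n))) *₅ (α ^₅ n) +₅ ((β *₅ β) *₅ Q (suc (suc n))) *₅ (β ^₅ n)
      ≡⟨ cong₂ (λ x y → x *₅ (α ^₅ n) +₅ y *₅ (β ^₅ n)) (proj₂ (proj₂ solutionP) n) (proj₂ (proj₂ solutionQ) n) ⟩
    (α *₅ P (suc n) +₅ P n +₅ PH n) *₅ (α ^₅ n) +₅ (β *₅ Q (suc n) +₅ Q n +₅ QH n) *₅ (β ^₅ n)
      ≡⟨ lem₂ α β (P (suc n)) (P n) (PH n) (Q (suc n)) (Q n) (QH n) (α ^₅ n) (β ^₅ n) ⟩
    u (suc n) +₅ u n +₅ (PH n *₅ (α ^₅ n) +₅ QH n *₅ (β ^₅ n))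
      ≡⟨ cong (u (suc n) +₅ u n +₅_) (sym (h≡ n)) ⟩
    u (suc n) +₅ u n +₅ h n ∎
    where
    lem₁ : ∀ a b p q x y → p *₅ (a *₅ (a *₅ x)) +₅ q *₅ (b *₅ (b *₅ y)) ≡ ((a *₅ a) *₅ p) *₅ x +₅ ((b *₅ b) *₅ q) *₅ y
    lem₁ = solve-∀ Q5-ring
    lem₂ : ∀ a b p₁ p₀ h q₁ q₀ k x y →
      (a *₅ p₁ +₅ p₀ +₅ h) *₅ x +₅ (b *₅ q₁ +₅ q₀ +₅ k) *₅ y
      ≡ (p₁ *₅ (a *₅ x) +₅ q₁ *₅ (b *₅ y)) +₅ (p₀ *₅ x +₅ q₀ *₅ y) +₅ (h *₅ x +₅ k *₅ y)
    lem₂ = solve-∀ Q5-ring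
  difference-rec : ∀ n → f (suc (suc n)) -₅ u (suc (suc n)) ≡ (f (suc n) -₅ u (suc n)) +₅ (f n -₅ u n)
  difference-rec n = trans (cong₂ _-₅_ (rec n) (u-rec n)) (lem (f (suc n)) (f n) (u (suc n)) (u n) (h n))
    where
    lem : ∀ f₁ f₀ u₁ u₀ h → (f₁ +₅ f₀ +₅ h) -₅ (u₁ +₅ u₀ +₅ h) ≡ (f₁ -₅ u₁) +₅ (f₀ -₅ u₀)
    lem = solve-∀ Q5-ring

-- Sums over subsets without consecutive elements

sumSubsets : (List ℕ → ℕ) → List ℕ → ℕ
sumSubsets f []       = f []
sumSubsets f (x ∷ xs) = sumSubsets (λ I → f (x ∷ I)) xs + sumSubsets f xs

sum-subsets : ∀ f xs → sum (map f (subsets xs)) ≡ sumSubsets f xs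
sum-subsets f []       = ℕ.+-identityʳ (f [])
sum-subsets f (x ∷ xs) = begin
  sum (map f (map (x ∷_) (subsets xs) ++ subsets xs))
    ≡⟨ cong sum (List.map-++ f (map (x ∷_) (subsets xs)) (subsets xs)) ⟩
  sum (map f (map (x ∷_) (subsets xs)) ++ map f (subsets xs))
    ≡⟨ sum-++ (map f (map (x ∷_) (subsets xs))) _ ⟩
  sum (map f (map (x ∷_) (subsets xs))) + sum (map f (subsets xs))
    ≡⟨ cong₂ _+_ (trans (cong sum (sym (List.map-∘ (subsets xs)))) (sum-subsets (λ I → f (x ∷ I)) xs)) (sum-subsets f xs) ⟩
  sumSubsets (λ I → f (x ∷ I)) xs + sumSubsets f xs ∎
  where open ≡-Reasoning

sum-filter : ∀ {A : Set} (p : A → Bool) (f : A → ℕ) xs →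
  sum (map f (filter (λ x → p x Data.Bool.≟ true) xs)) ≡ sum (map (λ x → if p x then f x else 0) xs)
sum-filter p f []       = refl
sum-filter p f (x ∷ xs) with p x
... | true  = cong (λ k → f x + k) (sum-filter p f xs)
... | false = sum-filter p f xs

-- `subsets` branches on the first entry, but the recurrence in n splits off the largest one, which
-- `A1` lists last.
sumSubsets-∷ʳ : ∀ f xs x → sumSubsets f (xs ∷ʳ x) ≡ sumSubsets (λ I → f (I ∷ʳ x)) xs + sumSubsets f xs
sumSubsets-∷ʳ f []       x = refl
sumSubsets-∷ʳ f (y ∷ xs) x = trans
  (cong₂ _+_ (sumSubsets-∷ʳ (λ I → f (y ∷ I)) xs x) (sumSubsets-∷ʳ f xs x))
  (interchange (sumSubsets (λ I → f (y ∷ (I ∷ʳ x))) xs) _ _ _)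
  where
  interchange : ∀ a b c d → (a + b) + (c + d) ≡ (a + c) + (b + d)
  interchange = solve-∀-ℕ

sumSubsets-cong : ∀ {P : ℕ → Set} {f g} → (∀ I → All P I → f I ≡ g I) →
  ∀ {xs} → All P xs → sumSubsets f xs ≡ sumSubsets g xs
sumSubsets-cong f≗g []         = f≗g [] []
sumSubsets-cong f≗g (px ∷ pxs) =
  cong₂ _+_ (sumSubsets-cong (λ I pI → f≗g _ (px ∷ pI)) pxs) (sumSubsets-cong f≗g pxs)

sumSubsets-0 : ∀ xs → sumSubsets (λ _ → 0) xs ≡ 0
sumSubsets-0 []       = refl
sumSubsets-0 (x ∷ xs) = cong₂ _+_ (sumSubsets-0 xs) (sumSubsets-0 xs)

sumSubsets-+ : ∀ f g xs → sumSubsets (λ I → f I + g I) xs ≡ sumSubsets f xs + sumSubsets g xs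
sumSubsets-+ f g []       = refl
sumSubsets-+ f g (x ∷ xs) = trans
  (cong₂ _+_ (sumSubsets-+ (λ I → f (x ∷ I)) (λ I → g (x ∷ I)) xs) (sumSubsets-+ f g xs))
  (interchange (sumSubsets (λ I → f (x ∷ I)) xs) _ _ _)
  where
  interchange : ∀ a b c d → (a + b) + (c + d) ≡ (a + c) + (b + d)
  interchange = solve-∀-ℕ

sumSubsets-* : ∀ k f xs → sumSubsets (λ I → k * f I) xs ≡ k * sumSubsets f xs
sumSubsets-* k f []       = refl
sumSubsets-* k f (x ∷ xs) = trans
  (cong₂ _+_ (sumSubsets-* k (λ I → f (x ∷ I)) xs) (sumSubsets-* k f xs))
  (sym (ℕ.*-distribˡ-+ k _ _))

∈ᵇ-∷ʳ : ∀ y xs x → y ∈ᵇ (xs ∷ʳ x) ≡ (y ∈ᵇ xs) ∨ ⌊ y ℕ.≟ x ⌋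
∈ᵇ-∷ʳ y []       x = Bool.∨-identityʳ _
∈ᵇ-∷ʳ y (z ∷ xs) x = trans (cong (⌊ y ℕ.≟ z ⌋ ∨_) (∈ᵇ-∷ʳ y xs x)) (sym (Bool.∨-assoc ⌊ y ℕ.≟ z ⌋ _ _))

≢⇒⌊≟⌋≡false : ∀ {x y} → x ≢ y → ⌊ x ℕ.≟ y ⌋ ≡ false
≢⇒⌊≟⌋≡false {x} {y} x≢y with x ℕ.≟ y
... | yes x≡y = contradiction x≡y x≢y
... | no  _   = refl

⌊≟⌋-refl : ∀ x → ⌊ x ℕ.≟ x ⌋ ≡ true
⌊≟⌋-refl x with x ℕ.≟ x
... | yes _   = refl
... | no  x≢x = contradiction refl x≢x

>all⇒∉ᵇ : ∀ {y xs} → All (_< y) xs → y ∈ᵇ xs ≡ false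
>all⇒∉ᵇ []           = refl
>all⇒∉ᵇ (x<y ∷ xs<y) = cong₂ _∨_ (≢⇒⌊≟⌋≡false (ℕ.>⇒≢ x<y)) (>all⇒∉ᵇ xs<y)

-- In `noConsecutive I` the list I is both traversed and searched. Separating the two roles allows
-- induction on J with K fixed; `noConsecutive I` is `noneFollowedIn I I`.
noneFollowedIn : List ℕ → List ℕ → Bool
noneFollowedIn K J = foldr (λ j r → not (suc j ∈ᵇ K) ∧ r) true J

noneFollowedIn-∷ʳʳ : ∀ K J x → noneFollowedIn K (J ∷ʳ x) ≡ noneFollowedIn K J ∧ not (suc x ∈ᵇ K)
noneFollowedIn-∷ʳʳ K []      x = Bool.∧-comm _ true
noneFollowedIn-∷ʳʳ K (y ∷ J) x =
  trans (cong (not (suc y ∈ᵇ K) ∧_) (noneFollowedIn-∷ʳʳ K J x)) (sym (Bool.∧-assoc (not (suc y ∈ᵇ K)) _ _))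

noneFollowedIn-∷ʳˡ : ∀ K {J x} → All (λ j → suc j < x) J → noneFollowedIn (K ∷ʳ x) J ≡ noneFollowedIn K J
noneFollowedIn-∷ʳˡ K []                   = refl
noneFollowedIn-∷ʳˡ K {y ∷ _} {x} (y<x ∷ J<x) = cong₂ (λ b r → not b ∧ r)
  (trans (∈ᵇ-∷ʳ (suc y) K x) (trans (cong ((suc y ∈ᵇ K) ∨_) (≢⇒⌊≟⌋≡false (ℕ.<⇒≢ y<x))) (Bool.∨-identityʳ _)))
  (noneFollowedIn-∷ʳˡ K J<x)

noConsecutive-∷ʳ-far : ∀ {J x} → All (λ j → suc j < x) J → noConsecutive (J ∷ʳ x) ≡ noConsecutive J
noConsecutive-∷ʳ-far {J} {x} J<x = begin
  noConsecutive (J ∷ʳ x)                                     ≡⟨ noneFollowedIn-∷ʳʳ (J ∷ʳ x) J x ⟩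
  noneFollowedIn (J ∷ʳ x) J ∧ not (suc x ∈ᵇ (J ∷ʳ x))        ≡⟨ cong₂ (λ b c → b ∧ not c) (noneFollowedIn-∷ʳˡ J J<x) (>all⇒∉ᵇ (All.∷ʳ⁺ (All.map (λ p → ℕ.<-trans (ℕ.n<1+n _) (ℕ.<-trans p (ℕ.n<1+n _))) J<x) (ℕ.n<1+n x))) ⟩
  noConsecutive J ∧ true                                     ≡⟨ Bool.∧-identityʳ _ ⟩
  noConsecutive J                                            ∎
  where open ≡-Reasoning

noConsecutive-∷ʳ-adjacent : ∀ J x → noConsecutive (J ∷ʳ x ∷ʳ suc x) ≡ false
noConsecutive-∷ʳ-adjacent J x = begin
  noConsecutive K                                             ≡⟨ noneFollowedIn-∷ʳʳ K (J ∷ʳ x) (suc x) ⟩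
  noneFollowedIn K (J ∷ʳ x) ∧ not (suc (suc x) ∈ᵇ K)          ≡⟨ cong (_∧ not (suc (suc x) ∈ᵇ K)) (noneFollowedIn-∷ʳʳ K J x) ⟩
  (noneFollowedIn K J ∧ not (suc x ∈ᵇ K)) ∧ _                 ≡⟨ cong (λ b → (noneFollowedIn K J ∧ not b) ∧ not (suc (suc x) ∈ᵇ K)) x+1∈K ⟩
  (noneFollowedIn K J ∧ false) ∧ _                            ≡⟨ cong (_∧ not (suc (suc x) ∈ᵇ K)) (Bool.∧-zeroʳ _) ⟩
  false                                                       ∎
  where
  open ≡-Reasoning
  K = J ∷ʳ x ∷ʳ suc x
  x+1∈K : suc x ∈ᵇ K ≡ true
  x+1∈K = trans (∈ᵇ-∷ʳ (suc x) (J ∷ʳ x) (suc x))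
    (trans (cong ((suc x ∈ᵇ (J ∷ʳ x)) ∨_) (⌊≟⌋-refl (suc x))) (Bool.∨-zeroʳ _))

A1-suc : ∀ n → A1 (suc n) ≡ A1 n ∷ʳ suc n
A1-suc n = trans (cong (map suc) (sym (List.upTo-∷ʳ n))) (List.map-++ suc (upTo n) (n ∷ []))

-- The bound j ≤ n in the form that `noConsecutive-∷ʳ-far` requires for appending n + 2.
A1-bounded : ∀ n → All (λ j → suc j < suc (suc n)) (A1 n)
A1-bounded zero    = []
A1-bounded (suc n) = subst (All _) (sym (A1-suc n))
  (All.∷ʳ⁺ (All.map (λ p → ℕ.<-trans p (ℕ.n<1+n _)) (A1-bounded n)) (ℕ.n<1+n _))

-- Inadmissible sets get weight 0, so sums can run over all subsets. As w sees I only through σ₀ and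
-- |I|, adjoining an element x becomes the substitution s ↦ s + x, l ↦ l + 1.
weigh : (ℕ → ℕ → ℕ) → List ℕ → ℕ
weigh w I = if noConsecutive I then w (sum I) (length I) else 0

total : ℕ → (ℕ → ℕ → ℕ) → ℕ
total n w = sumSubsets (weigh w) (A1 n)

total-cong : ∀ n {u v} → (∀ s l → u s l ≡ v s l) → total n u ≡ total n v
total-cong n {u} {v} u≗v = sumSubsets-cong pointwise (A1-bounded n)
  where
  pointwise : ∀ I → All _ I → weigh u I ≡ weigh v I
  pointwise I _ with noConsecutive I
  ... | true  = u≗v _ _
  ... | false = refl

total-+ : ∀ n u v → total n (λ s l → u s l + v s l) ≡ total n u + total n v
total-+ n u v = trans (sumSubsets-cong pointwise (A1-bounded n)) (sumSubsets-+ (weigh u) (weigh v) (A1 n))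
  where
  pointwise : ∀ I → All _ I → weigh (λ s l → u s l + v s l) I ≡ weigh u I + weigh v I
  pointwise I _ with noConsecutive I
  ... | true  = refl
  ... | false = refl

total-* : ∀ n k u → total n (λ s l → k * u s l) ≡ k * total n u
total-* n k u = trans (sumSubsets-cong pointwise (A1-bounded n)) (sumSubsets-* k (weigh u) (A1 n))
  where
  pointwise : ∀ I → All _ I → weigh (λ s l → k * u s l) I ≡ k * weigh u I
  pointwise I _ with noConsecutive I
  ... | true  = refl
  ... | false = sym (ℕ.*-zeroʳ k)

G⁺≡total : ∀ a b n → G⁺ a b n ≡ total n (λ s l → s ^ a * l ^ b)
G⁺≡total a b n = trans
  (sum-filter noConsecutive (λ I → σ₀ I ^ a * length I ^ b) (subsets (A1 n)))
  (sum-subsets (weigh (λ s l → s ^ a * l ^ b)) (A1 n))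

-- A set containing n + 2 cannot contain n + 1, hence the second summand.
total-recurrence : ∀ n w →
  total (suc (suc n)) w ≡ total (suc n) w + total n (λ s l → w (s + suc (suc n)) (suc l))
total-recurrence n w = begin
  sumSubsets W (A1 (suc (suc n)))
    ≡⟨ cong (sumSubsets W) (A1-suc (suc n)) ⟩
  sumSubsets W (A1 (suc n) ∷ʳ suc (suc n))
    ≡⟨ sumSubsets-∷ʳ W (A1 (suc n)) (suc (suc n)) ⟩
  sumSubsets W₂ (A1 (suc n)) + total (suc n) w
    ≡⟨ cong (λ xs → sumSubsets W₂ xs + total (suc n) w) (A1-suc n) ⟩
  sumSubsets W₂ (A1 n ∷ʳ suc n) + total (suc n) w
    ≡⟨ cong (_+ total (suc n) w) (sumSubsets-∷ʳ W₂ (A1 n) (suc n)) ⟩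
  (sumSubsets (λ I → W₂ (I ∷ʳ suc n)) (A1 n) + sumSubsets W₂ (A1 n)) + total (suc n) w
    ≡⟨ cong₂ (λ x y → (x + y) + total (suc n) w)
         (trans (sumSubsets-cong both (A1-bounded n)) (sumSubsets-0 (A1 n)))
         (sumSubsets-cong last-only (A1-bounded n)) ⟩
  total n w₂ + total (suc n) w
    ≡⟨ ℕ.+-comm (total n w₂) _ ⟩
  total (suc n) w + total n w₂ ∎
  where
  open ≡-Reasoning
  W = weigh w
  W₂ = λ I → W (I ∷ʳ suc (suc n))
  w₂ = λ s l → w (s + suc (suc n)) (suc l)
  both : ∀ I → All _ I → W₂ (I ∷ʳ suc n) ≡ 0
  both I _ rewrite noConsecutive-∷ʳ-adjacent I (suc n) = refl
  last-only : ∀ I → All (λ j → suc j < suc (suc n)) I → W₂ I ≡ weigh w₂ I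
  last-only I I< rewrite noConsecutive-∷ʳ-far I< with noConsecutive I
  ... | false = refl
  ... | true  = cong₂ w (trans (sum-++ I _) (cong (λ k → sum I + k) (ℕ.+-identityʳ _)))
    (trans (List.length-++ I) (ℕ.+-comm (length I) 1))

-- Leading coefficients

G : ℕ → ℕ → ℕ → ℕ
G a b n = total n (λ s l → s ^ a * l ^ b)

-- A half-expanded product: a′ and b′ count the factors still shifted, a and b those already
-- replaced by s and l. Expanding one factor at a time avoids binomial sums.
shiftedWeight : ℕ → ℕ → ℕ → ℕ → ℕ → ℕ → ℕ → ℕ
shiftedWeight m a′ b′ a b s l = (s + m) ^ a′ * suc l ^ b′ * (s ^ a * l ^ b)

F : ℕ → ℕ → ℕ → ℕ → ℕ → ℕ
F a′ b′ a b n = total n (shiftedWeight (suc (suc n)) a′ b′ a b)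

F-unshifted : ∀ a b n → F 0 0 a b n ≡ G a b n
F-unshifted a b n = total-cong n λ s l → ℕ.+-identityʳ (s ^ a * l ^ b)

F-suc-σ : ∀ a′ b′ a b n → F (suc a′) b′ a b n ≡ F a′ b′ (suc a) b n + suc (suc n) * F a′ b′ a b n
F-suc-σ a′ b′ a b n = trans
  (total-cong n λ s l → lem s (suc (suc n)) ((s + suc (suc n)) ^ a′) (suc l ^ b′) (s ^ a) (l ^ b))
  (trans (total-+ n (w (suc a)) (λ s l → suc (suc n) * w a s l))
    (cong (λ k → F a′ b′ (suc a) b n + k) (total-* n (suc (suc n)) (w a))))
  where
  w : ℕ → ℕ → ℕ → ℕ
  w a = shiftedWeight (suc (suc n)) a′ b′ a b
  lem : ∀ s m x y u v → (s + m) * x * y * (u * v) ≡ x * y * (s * u * v) + m * (x * y * (u * v))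
  lem = solve-∀-ℕ

F-suc-card : ∀ a′ b′ a b n → F a′ (suc b′) a b n ≡ F a′ b′ a (suc b) n + F a′ b′ a b n
F-suc-card a′ b′ a b n = trans
  (total-cong n λ s l → lem ((s + suc (suc n)) ^ a′) l (suc l ^ b′) (s ^ a) (l ^ b))
  (total-+ n (shiftedWeight (suc (suc n)) a′ b′ a (suc b)) (shiftedWeight (suc (suc n)) a′ b′ a b))
  where
  lem : ∀ x l y u v → x * (suc l * y) * (u * v) ≡ x * y * (u * (l * v)) + x * y * (u * v)
  lem = solve-∀-ℕ

G-recurrence : ∀ a b n → G a b (suc (suc n)) ≡ G a b (suc n) + F a b 0 0 n
G-recurrence a b n = trans (total-recurrence n (λ s l → s ^ a * l ^ b))
  (cong (λ k → G a b (suc n) + k) (total-cong n λ s l → sym (ℕ.*-identityʳ ((s + suc (suc n)) ^ a * suc l ^ b))))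

-- The coefficient of n^(2a+b) αⁿ in the main term.
lead : ℕ → ℕ → Q5
lead a b = (fromℚ ½ ^₅ a) *₅ (√5⁻¹ ^₅ (a + b + 1)) *₅ (α *₅ α) *₅ (α⁻¹ ^₅ (a + b))

κ : Q5
κ = α +₅ 1₅ +₅ 1₅

-- One more factor σ₀ brings ½ · √5⁻¹ · α⁻¹, which is 1/(2κ) because κ = α + 2 = √5 α.
lead-suc-σ : ∀ a b → lead a b ≡ (1₅ +₅ 1₅) *₅ κ *₅ lead (suc a) b
lead-suc-σ a b = lem (fromℚ ½ ^₅ a) (√5⁻¹ ^₅ (a + b + 1)) (α⁻¹ ^₅ (a + b))
  where
  lem : ∀ x y z → x *₅ y *₅ (α *₅ α) *₅ z
    ≡ (1₅ +₅ 1₅) *₅ (α +₅ 1₅ +₅ 1₅) *₅ ((fromℚ ½ *₅ x) *₅ (√5⁻¹ *₅ y) *₅ (α *₅ α) *₅ (α⁻¹ *₅ z))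
  lem = solve-∀ Q5-ring

lead-suc-card : ∀ a b → lead a b ≡ κ *₅ lead a (suc b)
lead-suc-card a b = trans (lem (fromℚ ½ ^₅ a) (√5⁻¹ ^₅ (a + b + 1)) (α⁻¹ ^₅ (a + b)))
  (cong (λ m → κ *₅ ((fromℚ ½ ^₅ a) *₅ (√5⁻¹ ^₅ (m + 1)) *₅ (α *₅ α) *₅ (α⁻¹ ^₅ m))) (sym (ℕ.+-suc a b)))
  where
  lem : ∀ x y z → x *₅ y *₅ (α *₅ α) *₅ z
    ≡ (α +₅ 1₅ +₅ 1₅) *₅ (x *₅ (√5⁻¹ *₅ y) *₅ (α *₅ α) *₅ (α⁻¹ *₅ z))
  lem = solve-∀ Q5-ring

HasLead : ℕ → ℕ → Set
HasLead a b = ExpPoly (suc (2 * a + b)) (lead a b) (λ n → ι (G a b n))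

record Shifted (a′ b′ a b A B : ℕ) : Set where
  constructor shifted
  field
    rest      : ℕ → ℕ
    split     : ∀ n → F a′ b′ a b n ≡ G A B n + rest n
    rest-lead : ExpPoly (2 * A + B) (ι (2 * a′ + b′) *₅ κ *₅ lead A B) (λ n → ι (rest n))

Shifted-F : ∀ {a′ b′ a b A B} → HasLead A B → Shifted a′ b′ a b A B →
  ExpPoly (suc (2 * A + B)) (lead A B) (λ n → ι (F a′ b′ a b n))
Shifted-F {A = A} {B} lead-G (shifted rest split rest-lead) = ExpPoly-cong (+₅-identityʳ (lead A B))
  (λ n → sym (trans (cong ι (split n)) (ι-+ (G A B n) (rest n))))
  (ExpPoly-+ lead-G (ExpPoly-weaken rest-lead))

ExpPoly-[n+2]* : ∀ {d c} {f : ℕ → ℕ} → ExpPoly d c (λ n → ι (f n)) →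
  ExpPoly (suc d) c (λ n → ι (suc (suc n) * f n))
ExpPoly-[n+2]* {c = c} {f} E = ExpPoly-cong (+₅-identityʳ c)
  (λ n → sym (trans (ι-* (suc (suc n)) (f n)) (trans (cong (_*₅ ι (f n)) (trans (ι-suc (suc n)) (cong (_+₅ 1₅) (ι-suc n)))) (lem (ι n) (ι (f n))))))
  (ExpPoly-+ (ExpPoly-n* E) (ExpPoly-weaken (ExpPoly-scale (1₅ +₅ 1₅) E)))
  where
  lem : ∀ x y → (x +₅ 1₅ +₅ 1₅) *₅ y ≡ x *₅ y +₅ (1₅ +₅ 1₅) *₅ y
  lem = solve-∀ Q5-ring

-- In the expansion of (σ + n + 2)^a′ (|I| + 1)^b′, the terms of the next order are those
-- replacing one of the a′ factors σ by n or one of the b′ factors |I| by 1. They contribute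
-- a′ lead (A - 1) B + b′ lead A (B - 1) = (2a′ + b′) κ lead A B.
shift-expansion : ∀ k → (∀ a b → a + b < k → HasLead a b) →
  ∀ a′ b′ a b {A B} → a′ + a ≡ A → b′ + b ≡ B → A + B ≤ k → Shifted a′ b′ a b A B
shift-expansion k IH zero zero a b refl refl _ = shifted (λ _ → 0)
  (λ n → trans (F-unshifted a b n) (sym (ℕ.+-identityʳ _)))
  (ExpPoly-cong (sym (trans (cong (λ z → z *₅ κ *₅ lead a b) ι-zero) (lem κ (lead a b)))) (λ _ → sym ι-zero) (ExpPoly-0 (2 * a + b)))
  where
  lem : ∀ x y → 0₅ *₅ x *₅ y ≡ 0₅
  lem = solve-∀ Q5-ring
shift-expansion k IH zero (suc b′) a b {A} {suc B} refl refl A+B≤k = shifted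
  (λ n → rest₁ n + F 0 b′ a b n)
  (λ n → trans (F-suc-card 0 b′ a b n) (trans (cong (_+ F 0 b′ a b n) (split₁ n)) (ℕ.+-assoc (G A (suc B) n) (rest₁ n) (F 0 b′ a b n))))
  (ExpPoly-cong coefficient (λ n → sym (ι-+ (rest₁ n) (F 0 b′ a b n)))
    (ExpPoly-+ rest-lead₁
      -- Losing one factor |I| lowers the degree by exactly one, so this summand reaches the top
      -- coefficient of the rest.
      (subst (λ d → ExpPoly d (lead A B) (λ n → ι (F 0 b′ a b n))) (sym (ℕ.+-suc (2 * A) B))
        (Shifted-F (IH A B A+B<k) (shift-expansion k IH zero b′ a b refl refl (ℕ.<⇒≤ A+B<k))))))
  where
  A+B<k : A + B < k
  A+B<k = subst (_≤ k) (ℕ.+-suc A B) A+B≤k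
  open Shifted (shift-expansion k IH zero b′ a (suc b) {A} {suc B} refl (ℕ.+-suc b′ b) A+B≤k)
    renaming (rest to rest₁; split to split₁; rest-lead to rest-lead₁)
  lem : ∀ x y z → x *₅ y *₅ z +₅ y *₅ z ≡ (x +₅ 1₅) *₅ y *₅ z
  lem = solve-∀ Q5-ring
  coefficient : ι b′ *₅ κ *₅ lead A (suc B) +₅ lead A B ≡ ι (suc b′) *₅ κ *₅ lead A (suc B)
  coefficient = trans (cong (ι b′ *₅ κ *₅ lead A (suc B) +₅_) (lead-suc-card A B))
    (trans (lem (ι b′) κ (lead A (suc B))) (cong (λ z → z *₅ κ *₅ lead A (suc B)) (sym (ι-suc b′))))
shift-expansion k IH (suc a′) b′ a b {suc A} {B} refl refl A+B<k = shifted
  (λ n → rest₁ n + suc (suc n) * F a′ b′ a b n)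
  (λ n → trans (F-suc-σ a′ b′ a b n) (trans (cong (_+ suc (suc n) * F a′ b′ a b n) (split₁ n)) (ℕ.+-assoc (G (suc A) B n) (rest₁ n) (suc (suc n) * F a′ b′ a b n))))
  (ExpPoly-cong coefficient (λ n → sym (ι-+ (rest₁ n) (suc (suc n) * F a′ b′ a b n)))
    (ExpPoly-+ rest-lead₁
      -- Losing one factor σ₀ lowers the degree by two and n + 2 restores one, so this summand too
      -- reaches the top coefficient.
      (subst (λ d → ExpPoly d (lead A B) (λ n → ι (suc (suc n) * F a′ b′ a b n))) (sym (degree A B))
        (ExpPoly-[n+2]* {f = F a′ b′ a b} (Shifted-F (IH A B A+B<k) (shift-expansion k IH a′ b′ a b refl refl (ℕ.<⇒≤ A+B<k)))))))
  where
  open Shifted (shift-expansion k IH a′ b′ (suc a) b {suc A} {B} (ℕ.+-suc a′ a) refl A+B<k)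
    renaming (rest to rest₁; split to split₁; rest-lead to rest-lead₁)
  degree : ∀ A B → 2 * suc A + B ≡ suc (suc (2 * A + B))
  degree = solve-∀-ℕ
  lem : ∀ x y z → x *₅ y *₅ z +₅ (1₅ +₅ 1₅) *₅ y *₅ z ≡ (x +₅ 1₅ +₅ 1₅) *₅ y *₅ z
  lem = solve-∀ Q5-ring
  coefficient : ι (2 * a′ + b′) *₅ κ *₅ lead (suc A) B +₅ lead A B ≡ ι (2 * suc a′ + b′) *₅ κ *₅ lead (suc A) B
  coefficient = trans (cong (ι (2 * a′ + b′) *₅ κ *₅ lead (suc A) B +₅_) (lead-suc-σ A B))
    (trans (lem (ι (2 * a′ + b′)) κ (lead (suc A) B))
      (cong (λ z → z *₅ κ *₅ lead (suc A) B)
        (sym (trans (cong ι (degree a′ b′)) (trans (ι-suc _) (cong (_+₅ 1₅) (ι-suc _)))))))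

G₀₀-recurrence : ∀ n → ι (G 0 0 (suc (suc n))) ≡ ι (G 0 0 (suc n)) +₅ ι (G 0 0 n)
G₀₀-recurrence n = trans (cong ι (trans (G-recurrence 0 0 n) (cong (λ k → G 0 0 (suc n) + k) (F-unshifted 0 0 n))))
  (ι-+ (G 0 0 (suc n)) (G 0 0 n))

-- With every factor still shifted, `Shifted` yields the coefficient (2a + b) κ `lead a b`, and
-- solving the recurrence divides it by (2a + b) κ. This takes 2a + b > 0, hence the `suc e`.
HasLead-step : ∀ a b e → 2 * a + b ≡ suc e → (∀ i j → i + j < a + b → HasLead i j) → HasLead a b
HasLead-step a b e deg IH = subst (λ d → ExpPoly (suc d) (lead a b) (λ n → ι (G a b n))) (sym deg)
  (ExpPoly-recurrence e recurrence
    (subst (λ d → ExpPoly d (ι d *₅ κ *₅ lead a b) (λ n → ι (rest n))) deg rest-lead))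
  where
  open Shifted (shift-expansion (a + b) IH a b 0 0 (ℕ.+-identityʳ a) (ℕ.+-identityʳ b) ℕ.≤-refl)
  open ≡-Reasoning
  recurrence : ∀ n → ι (G a b (suc (suc n))) ≡ ι (G a b (suc n)) +₅ ι (G a b n) +₅ ι (rest n)
  recurrence n = begin
    ι (G a b (suc (suc n)))                         ≡⟨ cong ι (trans (G-recurrence a b n) (cong (λ k → G a b (suc n) + k) (split n))) ⟩
    ι (G a b (suc n) + (G a b n + rest n))          ≡⟨ cong ι (sym (ℕ.+-assoc (G a b (suc n)) (G a b n) (rest n))) ⟩
    ι (G a b (suc n) + G a b n + rest n)            ≡⟨ ι-+ (G a b (suc n) + G a b n) (rest n) ⟩
    ι (G a b (suc n) + G a b n) +₅ ι (rest n)       ≡⟨ cong (_+₅ ι (rest n)) (ι-+ (G a b (suc n)) (G a b n)) ⟩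
    ι (G a b (suc n)) +₅ ι (G a b n) +₅ ι (rest n)  ∎

hasLead-below : ∀ k a b → a + b < k → HasLead a b
hasLead-below (suc k) zero zero _ = ExpPoly-cong
  -- The counts of admissible sets are 1 for n = 0 and 2 for n = 1, and 2 - β = α²: the origin of
  -- the exponent n + 2 in the main term.
  (trans (cong₂ (λ x y → √5⁻¹ *₅ (x -₅ β *₅ y)) ι2 ι1) refl) (λ _ → refl)
  (ExpPoly-fibonacci (λ n → ι (G 0 0 n)) G₀₀-recurrence)
  where
  ι1 : ι 1 ≡ 1₅
  ι1 = trans (ι-suc 0) (cong (_+₅ 1₅) ι-zero)
  ι2 : ι 2 ≡ 1₅ +₅ 1₅
  ι2 = trans (ι-suc 1) (cong (_+₅ 1₅) ι1)
hasLead-below (suc k) zero    (suc b) (s≤s b≤k) =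
  HasLead-step 0 (suc b) b refl λ i j i+j< → hasLead-below k i j (ℕ.<-≤-trans i+j< b≤k)
hasLead-below (suc k) (suc a) b       (s≤s a+b≤k) =
  HasLead-step (suc a) b _ refl λ i j i+j< → hasLead-below k i j (ℕ.<-≤-trans i+j< a+b≤k)

hasLead : ∀ a b → HasLead a b
hasLead a b = hasLead-below (suc (a + b)) a b (ℕ.n<1+n (a + b))

-- Signs and bounds in ℚ(√5)

0≤+ : ∀ {p q} → 0ℚ ℚ.≤ p → 0ℚ ℚ.≤ q → 0ℚ ℚ.≤ p ℚ.+ q
0≤+ 0≤p 0≤q = ℚ.+-mono-≤ 0≤p 0≤q

0≤* : ∀ {p q} → 0ℚ ℚ.≤ p → 0ℚ ℚ.≤ q → 0ℚ ℚ.≤ p ℚ.* q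
0≤* {p} {q} 0≤p 0≤q = ℚ.nonNegative⁻¹ (p ℚ.* q)
  {{ℚ.nonNeg*nonNeg⇒nonNeg p {{ℚ.nonNegative 0≤p}} q {{ℚ.nonNegative 0≤q}}}}

0≤5ℚ : 0ℚ ℚ.≤ 5ℚ
0≤5ℚ = ℚ.nonNegative⁻¹ 5ℚ

p≤p+q : ∀ p {q} → 0ℚ ℚ.≤ q → p ℚ.≤ p ℚ.+ q
p≤p+q p {q} 0≤q = subst (ℚ._≤ p ℚ.+ q) (ℚ.+-identityʳ p) (ℚ.+-monoʳ-≤ p 0≤q)

0≤q-p : ∀ {p q} → p ℚ.≤ q → 0ℚ ℚ.≤ q ℚ.- p
0≤q-p {p} {q} p≤q = subst (ℚ._≤ q ℚ.- p) (ℚ.+-inverseʳ p) (ℚ.+-monoˡ-≤ (ℚ.- p) p≤q)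

square-cancel-≤ : ∀ {p q} → 0ℚ ℚ.≤ q → p ℚ.* p ℚ.≤ q ℚ.* q → p ℚ.≤ q
square-cancel-≤ {p} {q} 0≤q p²≤q² with p ℚ.≤? q
... | yes p≤q = p≤q
... | no  p≰q = contradiction refl (ℚ.<⇒≢ (ℚ.≤-<-trans p²≤q² (ℚ.≤-<-trans
  (ℚ.*-monoˡ-≤-nonNeg q {{ℚ.nonNegative 0≤q}} (ℚ.<⇒≤ q<p))
  (ℚ.*-monoˡ-<-pos p {{ℚ.positive (ℚ.≤-<-trans 0≤q q<p)}} q<p))))
  where
  q<p = ℚ.≰⇒> p≰q

-- The sign of the norm x² − 5y² is the case split of NonNeg; multiplication by α⁻¹, of norm −1, swaps the two cases.
data SignCases (u : Q5) : Set where
  norm≥0 : 0ℚ ℚ.≤ re u → 5ℚ ℚ.* (im u ℚ.* im u) ℚ.≤ re u ℚ.* re u → SignCases u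
  norm≤0 : 0ℚ ℚ.≤ im u → re u ℚ.* re u ℚ.≤ 5ℚ ℚ.* (im u ℚ.* im u) → SignCases u

SignCases⇒NonNeg : ∀ {u} → SignCases u → NonNeg u
SignCases⇒NonNeg (norm≥0 0≤x p) = inj₂ (inj₁ (0≤x , p))
SignCases⇒NonNeg (norm≤0 0≤y p) = inj₂ (inj₂ (0≤y , p))

≤-by-difference : ∀ {p q r s} → r ℚ.≤ s → p ℚ.+ (s ℚ.- r) ≡ q → p ℚ.≤ q
≤-by-difference {p} r≤s eq = subst (p ℚ.≤_) eq (p≤p+q p (0≤q-p r≤s))

SignCases-α⁻¹ : ∀ {u} → SignCases u → SignCases (u *₅ α⁻¹)
SignCases-α⁻¹ {⟨ p , r ⟩} (norm≥0 0≤p 5r²≤p²) = norm≤0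
  -- The new √5-coordinate is (p - r)/2, and r² ≤ 5r² ≤ p² gives r ≤ p.
  (subst (0ℚ ℚ.≤_) (im-eq p r) (0≤* (ℚ.nonNegative⁻¹ ½) (0≤q-p (square-cancel-≤ 0≤p (ℚ.≤-trans r²≤5r² 5r²≤p²)))))
  (≤-by-difference 5r²≤p² (norm-eq p r))
  where
  im-eq : ∀ p r → ½ ℚ.* (p ℚ.- r) ≡ p ℚ.* ½ ℚ.+ r ℚ.* (ℚ.- ½)
  im-eq = solve-∀ ℚ-ring
  4ℚ = + 4 / 1
  5≡1+4 : ∀ r → r ℚ.* r ℚ.+ (4ℚ ℚ.* (r ℚ.* r)) ≡ 5ℚ ℚ.* (r ℚ.* r)
  5≡1+4 = solve-∀ ℚ-ring
  0≤r² : 0ℚ ℚ.≤ r ℚ.* r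
  0≤r² with ℚ.≤-total 0ℚ r
  ... | inj₁ 0≤r = 0≤* 0≤r 0≤r
  ... | inj₂ r≤0 = subst (0ℚ ℚ.≤_) (lem r) (0≤* (ℚ.neg-antimono-≤ r≤0) (ℚ.neg-antimono-≤ r≤0))
    where
    lem : ∀ r → (ℚ.- r) ℚ.* (ℚ.- r) ≡ r ℚ.* r
    lem = solve-∀ ℚ-ring
  r²≤5r² : r ℚ.* r ℚ.≤ 5ℚ ℚ.* (r ℚ.* r)
  r²≤5r² = subst (r ℚ.* r ℚ.≤_) (5≡1+4 r) (p≤p+q (r ℚ.* r) (0≤* (ℚ.nonNegative⁻¹ 4ℚ) 0≤r²))
  norm-eq : ∀ p r →
    (p ℚ.* (ℚ.- ½) ℚ.+ 5ℚ ℚ.* (r ℚ.* ½)) ℚ.* (p ℚ.* (ℚ.- ½) ℚ.+ 5ℚ ℚ.* (r ℚ.* ½)) ℚ.+ (p ℚ.* p ℚ.- 5ℚ ℚ.* (r ℚ.* r))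
    ≡ 5ℚ ℚ.* ((p ℚ.* ½ ℚ.+ r ℚ.* (ℚ.- ½)) ℚ.* (p ℚ.* ½ ℚ.+ r ℚ.* (ℚ.- ½)))
  norm-eq = solve-∀ ℚ-ring
SignCases-α⁻¹ {⟨ p , r ⟩} (norm≤0 0≤r p²≤5r²) = norm≥0
  -- The new rational coordinate is (5r - p)/2, and p² ≤ 5r² ≤ (5r)² gives p ≤ 5r.
  (subst (0ℚ ℚ.≤_) (re-eq p r) (0≤* (ℚ.nonNegative⁻¹ ½) (0≤q-p (square-cancel-≤ (0≤* 0≤5ℚ 0≤r) (ℚ.≤-trans p²≤5r² 5r²≤25r²)))))
  (≤-by-difference p²≤5r² (norm-eq p r))
  where
  re-eq : ∀ p r → ½ ℚ.* (5ℚ ℚ.* r ℚ.- p) ≡ p ℚ.* (ℚ.- ½) ℚ.+ 5ℚ ℚ.* (r ℚ.* ½)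
  re-eq = solve-∀ ℚ-ring
  20ℚ = + 20 / 1
  25≡5+20 : ∀ r → 5ℚ ℚ.* (r ℚ.* r) ℚ.+ 20ℚ ℚ.* (r ℚ.* r) ≡ (5ℚ ℚ.* r) ℚ.* (5ℚ ℚ.* r)
  25≡5+20 = solve-∀ ℚ-ring
  5r²≤25r² : 5ℚ ℚ.* (r ℚ.* r) ℚ.≤ (5ℚ ℚ.* r) ℚ.* (5ℚ ℚ.* r)
  5r²≤25r² = subst (5ℚ ℚ.* (r ℚ.* r) ℚ.≤_) (25≡5+20 r) (p≤p+q (5ℚ ℚ.* (r ℚ.* r)) (0≤* (ℚ.nonNegative⁻¹ 20ℚ) (0≤* 0≤r 0≤r)))
  norm-eq : ∀ p r →
    5ℚ ℚ.* ((p ℚ.* ½ ℚ.+ r ℚ.* (ℚ.- ½)) ℚ.* (p ℚ.* ½ ℚ.+ r ℚ.* (ℚ.- ½))) ℚ.+ (5ℚ ℚ.* (r ℚ.* r) ℚ.- p ℚ.* p)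
    ≡ (p ℚ.* (ℚ.- ½) ℚ.+ 5ℚ ℚ.* (r ℚ.* ½)) ℚ.* (p ℚ.* (ℚ.- ½) ℚ.+ 5ℚ ℚ.* (r ℚ.* ½))
  norm-eq = solve-∀ ℚ-ring

record Cone (u : Q5) : Set where
  constructor cone
  field
    re≥0 : 0ℚ ℚ.≤ re u
    im≥0 : 0ℚ ℚ.≤ im u

Cone⇒SignCases : ∀ {u} → Cone u → SignCases u
Cone⇒SignCases {⟨ x , y ⟩} (cone 0≤x 0≤y) with ℚ.≤-total (5ℚ ℚ.* (y ℚ.* y)) (x ℚ.* x)
... | inj₁ p = norm≥0 0≤x p
... | inj₂ p = norm≤0 0≤y p

SignCases-α^ : ∀ n {u} → SignCases (u *₅ (α ^₅ n)) → SignCases u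
SignCases-α^ zero    {u} S = subst SignCases (lem u) S
  where
  lem : ∀ u → u *₅ 1₅ ≡ u
  lem = solve-∀ Q5-ring
SignCases-α^ (suc n) {u} S = SignCases-α^ n (subst SignCases (lem u (α ^₅ n)) (SignCases-α⁻¹ S))
  where
  lem : ∀ u x → u *₅ (α *₅ x) *₅ α⁻¹ ≡ u *₅ x
  lem = solve-∀ Q5-ring

-- x + y√5 ≥ 0 as soon as some (x + y√5) αⁿ has nonnegative coordinates.
Cone-α^⇒NonNeg : ∀ n {u} → Cone (u *₅ (α ^₅ n)) → NonNeg u
Cone-α^⇒NonNeg n c = SignCases⇒NonNeg (SignCases-α^ n (Cone⇒SignCases c))

Cone-+ : ∀ {u v} → Cone u → Cone v → Cone (u +₅ v)
Cone-+ (cone a b) (cone c d) = cone (0≤+ a c) (0≤+ b d)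

Cone-* : ∀ {u v} → Cone u → Cone v → Cone (u *₅ v)
Cone-* (cone a b) (cone c d) = cone (0≤+ (0≤* a c) (0≤* 0≤5ℚ (0≤* b d))) (0≤+ (0≤* a d) (0≤* b c))

Cone-0 : Cone 0₅
Cone-0 = cone ℚ.≤-refl ℚ.≤-refl

Cone-1 : Cone 1₅
Cone-1 = cone (ℚ.nonNegative⁻¹ 1ℚ) ℚ.≤-refl

Cone-½ : Cone (fromℚ ½)
Cone-½ = cone (ℚ.nonNegative⁻¹ ½) ℚ.≤-refl

Cone-α : Cone α
Cone-α = cone (ℚ.nonNegative⁻¹ ½) (ℚ.nonNegative⁻¹ ½)

Cone-^ : ∀ {u} n → Cone u → Cone (u ^₅ n)
Cone-^ zero    c = Cone-1
Cone-^ (suc n) c = Cone-* c (Cone-^ n c)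

Cone-ι : ∀ n → Cone (ι n)
Cone-ι zero    = subst Cone (sym ι-zero) Cone-0
Cone-ι (suc n) = subst Cone (sym (ι-suc n)) (Cone-+ (Cone-ι n) Cone-1)

Cone-1/ : ∀ n → Cone (fromℚ (+ 1 / suc n))
Cone-1/ n = cone (ℚ.nonNegative⁻¹ (+ 1 / suc n) {{ℚ.normalize-nonNeg 1 (suc n)}}) ℚ.≤-refl

-- The coordinatewise order and absolute bounds

infix 4 _≼_ _≪_

record _≼_ (u v : Q5) : Set where
  constructor below
  field difference : Cone (v -₅ u)

-- |u| ≤ e, with respect to Cone.
record _≪_ (u e : Q5) : Set where
  constructor between
  field
    lower : Cone (e +₅ u)
    upper : Cone (e -₅ u)

≼-* : ∀ {u v w x} → Cone u → Cone x → u ≼ v → w ≼ x → u *₅ w ≼ v *₅ x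
≼-* {u} {v} {w} {x} cu cx (below p) (below q) =
  below (subst Cone (lem u v w x) (Cone-+ (Cone-* p cx) (Cone-* cu q)))
  where
  lem : ∀ u v w x → (v -₅ u) *₅ x +₅ u *₅ (x -₅ w) ≡ v *₅ x -₅ u *₅ w
  lem = solve-∀ Q5-ring

≼-refl : ∀ u → u ≼ u
≼-refl u = below (subst Cone (lem u) Cone-0)
  where
  lem : ∀ u → 0₅ ≡ u -₅ u
  lem = solve-∀ Q5-ring

≪-≼-trans : ∀ {u e f} → u ≪ e → e ≼ f → u ≪ f
≪-≼-trans {u} {e} {f} (between p q) (below d) =
  between (subst Cone (lem₁ u e f) (Cone-+ p d)) (subst Cone (lem₂ u e f) (Cone-+ q d))
  where
  lem₁ : ∀ u e f → (e +₅ u) +₅ (f -₅ e) ≡ f +₅ u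
  lem₁ = solve-∀ Q5-ring
  lem₂ : ∀ u e f → (e -₅ u) +₅ (f -₅ e) ≡ f -₅ u
  lem₂ = solve-∀ Q5-ring

≪-+ : ∀ {u v e f} → u ≪ e → v ≪ f → u +₅ v ≪ e +₅ f
≪-+ {u} {v} {e} {f} (between p q) (between p′ q′) =
  between (subst Cone (lem₁ u v e f) (Cone-+ p p′)) (subst Cone (lem₂ u v e f) (Cone-+ q q′))
  where
  lem₁ : ∀ u v e f → (e +₅ u) +₅ (f +₅ v) ≡ (e +₅ f) +₅ (u +₅ v)
  lem₁ = solve-∀ Q5-ring
  lem₂ : ∀ u v e f → (e -₅ u) +₅ (f -₅ v) ≡ (e +₅ f) -₅ (u +₅ v)
  lem₂ = solve-∀ Q5-ring

-- Both ef + uv and ef - uv are half a sum of two products of the cone elements e ± u and f ± v, so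
-- the signs of u and v never matter.
≪-* : ∀ {u v e f} → u ≪ e → v ≪ f → u *₅ v ≪ e *₅ f
≪-* {u} {v} {e} {f} (between p q) (between p′ q′) = between
  (subst Cone (lem₁ u v e f) (Cone-* Cone-½ (Cone-+ (Cone-* p p′) (Cone-* q q′))))
  (subst Cone (lem₂ u v e f) (Cone-* Cone-½ (Cone-+ (Cone-* p q′) (Cone-* q p′))))
  where
  lem₁ : ∀ u v e f → fromℚ ½ *₅ ((e +₅ u) *₅ (f +₅ v) +₅ (e -₅ u) *₅ (f -₅ v)) ≡ e *₅ f +₅ u *₅ v
  lem₁ = solve-∀ Q5-ring
  lem₂ : ∀ u v e f → fromℚ ½ *₅ ((e +₅ u) *₅ (f -₅ v) +₅ (e -₅ u) *₅ (f +₅ v)) ≡ e *₅ f -₅ u *₅ v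
  lem₂ = solve-∀ Q5-ring

Cone⇒≪-refl : ∀ {u} → Cone u → u ≪ u
Cone⇒≪-refl {u} c = between (Cone-+ c c) (_≼_.difference (≼-refl u))

0≪ : ∀ {e} → Cone e → 0₅ ≪ e
0≪ {e} c = between (subst Cone (lem₁ e) c) (subst Cone (lem₂ e) c)
  where
  lem₁ : ∀ e → e ≡ e +₅ 0₅
  lem₁ = solve-∀ Q5-ring
  lem₂ : ∀ e → e ≡ e -₅ 0₅
  lem₂ = solve-∀ Q5-ring

-- Denominators are at least 1, so a fraction never exceeds the absolute value of its numerator.
∣↥∣≤⇒≤ : ∀ p {m} → ℤ.∣ ℚ.↥ p ∣ ℕ.≤ m → p ℚ.≤ + m / 1
∣↥∣≤⇒≤ p {m} ∣↥p∣≤m = ℚ.toℚᵘ-cancel-≤ (ℚᵘ.≤-respʳ-≃ (ℚᵘ.≃-sym (ℚ.toℚᵘ-fromℚᵘ (ℚᵘ.mkℚᵘ (+ m) 0))) (bound p ∣↥p∣≤m))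
  where
  bound : ∀ p → ℤ.∣ ℚ.↥ p ∣ ℕ.≤ m → ℚ.toℚᵘ p ℚᵘ.≤ ℚᵘ.mkℚᵘ (+ m) 0
  bound (mkℚ (+ k)    d _) k≤m = ℚᵘ.*≤* (subst₂ ℤ._≤_ (ℤ.pos-* k 1) (ℤ.pos-* m (suc d)) (ℤ.+≤+ (ℕ.*-mono-≤ k≤m (ℕ.s≤s ℕ.z≤n))))
  bound (mkℚ -[1+ k ] d _) _   = ℚᵘ.*≤* (subst (ℤ._≤_ _) (ℤ.pos-* m (suc d)) ℤ.-≤+)

-- ι 2 · α = 1 + √5 has equal coordinates, so one integer multiple of α bounds both coordinates of c.
constant-bound : ∀ c → Σ ℕ λ C → c ≪ ι C *₅ α
constant-bound c = n ℕ.+ n , subst (c ≪_) (sym multiple-of-α) (between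
    (cone (subst (0ℚ ℚ.≤_) (minus-neg (re c) N) (0≤q-p (-≤N (re c) re≤n))) (subst (0ℚ ℚ.≤_) (minus-neg (im c) N) (0≤q-p (-≤N (im c) im≤n))))
    (cone (0≤q-p (∣↥∣≤⇒≤ (re c) re≤n)) (0≤q-p (∣↥∣≤⇒≤ (im c) im≤n))))
  where
  n = ℤ.∣ ℚ.↥ (re c) ∣ ℕ.+ ℤ.∣ ℚ.↥ (im c) ∣
  N = + n / 1
  re≤n : ℤ.∣ ℚ.↥ (re c) ∣ ℕ.≤ n
  re≤n = ℕ.m≤m+n ℤ.∣ ℚ.↥ (re c) ∣ ℤ.∣ ℚ.↥ (im c) ∣
  im≤n : ℤ.∣ ℚ.↥ (im c) ∣ ℕ.≤ n
  im≤n = ℕ.m≤n+m ℤ.∣ ℚ.↥ (im c) ∣ ℤ.∣ ℚ.↥ (re c) ∣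
  -≤N : ∀ p → ℤ.∣ ℚ.↥ p ∣ ℕ.≤ n → ℚ.- p ℚ.≤ N
  -≤N p ∣↥p∣≤n = ∣↥∣≤⇒≤ (ℚ.- p) (subst (ℕ._≤ n) (sym (trans (cong ℤ.∣_∣ (ℚ.↥-neg p)) (ℤ.∣-i∣≡∣i∣ (ℚ.↥ p)))) ∣↥p∣≤n)
  minus-neg : ∀ x y → y ℚ.- (ℚ.- x) ≡ y ℚ.+ x
  minus-neg = solve-∀ ℚ-ring
  multiple-of-α : ι (n ℕ.+ n) *₅ α ≡ ⟨ N , N ⟩
  multiple-of-α = trans (cong (_*₅ α) (ι-+ n n)) (trans (cong (λ x → (x +₅ x) *₅ α) (ι≡fromℕ n)) (Q5-≡ (lem₁ N) (lem₂ N)))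
    where
    lem₁ : ∀ x → (x ℚ.+ x) ℚ.* ½ ℚ.+ 5ℚ ℚ.* ((0ℚ ℚ.+ 0ℚ) ℚ.* ½) ≡ x
    lem₁ = solve-∀ ℚ-ring
    lem₂ : ∀ x → (x ℚ.+ x) ℚ.* ½ ℚ.+ (0ℚ ℚ.+ 0ℚ) ℚ.* ½ ≡ x
    lem₂ = solve-∀ ℚ-ring

Cone-α-ι-1/ : ∀ C d m → Cone (ι C *₅ α *₅ (ι (suc m) ^₅ d *₅ fromℚ (+ 1 / suc m)))
Cone-α-ι-1/ C d m = Cone-* (Cone-* (Cone-ι C) Cone-α) (Cone-* (Cone-^ d (Cone-ι (suc m))) (Cone-1/ m))

-- The factor α is inherited from `constant-bound`: coordinatewise, no rational bounds a constant
-- with a nonzero √5-part. The powers of α absorb it later. Writing n^(d-1) as n^d · n⁻¹ matches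
-- `errScale` and covers d = 0.
Poly-bound : ∀ {d c f} → Poly d c f → Σ ℕ λ C → ∀ m →
  f (suc m) ≪ ι C *₅ α *₅ (ι (suc m) ^₅ d *₅ fromℚ (+ 1 / suc m))
Poly-bound (vanishing _ f≡0) = 0 , λ m → subst (_≪ _) (sym (f≡0 (suc m))) (0≪ (Cone-α-ι-1/ 0 0 m))
Poly-bound {suc d} {c} {f} (leading g Pg f≡) = C₁ ℕ.+ C₂ , bound
  where
  C₁ = proj₁ (constant-bound c)
  C₂ = proj₁ (Poly-bound Pg)
  module _ (m : ℕ) where
    n = ι (suc m)
    n⁻¹ = fromℚ (+ 1 / suc m)
    E = n ^₅ d *₅ n⁻¹
    power : n ^₅ d ≡ n ^₅ suc d *₅ n⁻¹
    power = trans (lem₁ (n ^₅ d)) (trans (cong (n ^₅ d *₅_) (sym (ι-inverse m))) (lem₂ n (n ^₅ d) n⁻¹))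
      where
      lem₁ : ∀ x → x ≡ x *₅ 1₅
      lem₁ = solve-∀ Q5-ring
      lem₂ : ∀ n x y → x *₅ (n *₅ y) ≡ n *₅ x *₅ y
      lem₂ = solve-∀ Q5-ring
    -- Since n = m + 1, the difference nE - E is mE.
    E≼nE : E ≼ n ^₅ suc d *₅ n⁻¹
    E≼nE = below (subst Cone (trans (lem (ι m) (n ^₅ d) n⁻¹) (cong (λ z → z *₅ (n ^₅ d) *₅ n⁻¹ -₅ E) (sym (ι-suc m))))
      (Cone-* (Cone-ι m) (Cone-* (Cone-^ d (Cone-ι (suc m))) (Cone-1/ m))))
      where
      lem : ∀ k x y → k *₅ (x *₅ y) ≡ (k +₅ 1₅) *₅ x *₅ y -₅ x *₅ y
      lem = solve-∀ Q5-ring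
    leading-bound : c *₅ (n ^₅ d) ≪ ι C₁ *₅ α *₅ (n ^₅ suc d *₅ n⁻¹)
    leading-bound = subst (λ z → c *₅ (n ^₅ d) ≪ ι C₁ *₅ α *₅ z) power
      (≪-* (proj₂ (constant-bound c)) (Cone⇒≪-refl (Cone-^ d (Cone-ι (suc m)))))
    rest-bound : g (suc m) ≪ ι C₂ *₅ α *₅ (n ^₅ suc d *₅ n⁻¹)
    rest-bound = ≪-≼-trans (proj₂ (Poly-bound Pg) m)
      (≼-* (Cone-* (Cone-ι C₂) Cone-α) (Cone-* (Cone-^ (suc d) (Cone-ι (suc m))) (Cone-1/ m)) (≼-refl (ι C₂ *₅ α)) E≼nE)
    bound : f (suc m) ≪ ι (C₁ ℕ.+ C₂) *₅ α *₅ (n ^₅ suc d *₅ n⁻¹)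
    bound = subst₂ _≪_ (sym (f≡ (suc m)))
      (trans (lem (ι C₁) (ι C₂) (n ^₅ suc d *₅ n⁻¹)) (cong (λ z → z *₅ α *₅ (n ^₅ suc d *₅ n⁻¹)) (sym (ι-+ C₁ C₂))))
      (≪-+ leading-bound rest-bound)
      where
      lem : ∀ x y z → x *₅ α *₅ z +₅ y *₅ α *₅ z ≡ (x +₅ y) *₅ α *₅ z
      lem = solve-∀ Q5-ring

-- Growth of the powers of α

2₅ : Q5
2₅ = 1₅ +₅ 1₅

Cone-α^ : ∀ n → Cone (α ^₅ n)
Cone-α^ n = Cone-^ n Cone-α

α≼α^suc : ∀ m → α ≼ α ^₅ suc m
α≼α^suc zero    = below (subst Cone refl Cone-0)
α≼α^suc (suc m) = below (subst Cone (lem (α ^₅ m)) (Cone-+ (_≼_.difference (α≼α^suc m)) (Cone-α^ m)))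
  where
  lem : ∀ x → (α *₅ x -₅ α) +₅ x ≡ α *₅ (α *₅ x) -₅ α
  lem = solve-∀ Q5-ring

-- Without the factor 2 this fails at n = 1: α - 1 has rational coordinate -½, whereas 2α - 1 = √5.
1≼2α^ : ∀ n → 1₅ ≼ 2₅ *₅ (α ^₅ n)
1≼2α^ zero          = below Cone-1
1≼2α^ (suc zero)    = below (cone ℚ.≤-refl (ℚ.nonNegative⁻¹ 1ℚ))
1≼2α^ (suc (suc n)) = below (subst Cone (lem (α ^₅ n))
  (Cone-+ (_≼_.difference (1≼2α^ (suc n))) (Cone-* (Cone-+ Cone-1 Cone-1) (Cone-α^ n))))
  where
  lem : ∀ x → ((1₅ +₅ 1₅) *₅ (α *₅ x) -₅ 1₅) +₅ (1₅ +₅ 1₅) *₅ x ≡ (1₅ +₅ 1₅) *₅ (α *₅ (α *₅ x)) -₅ 1₅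
  lem = solve-∀ Q5-ring

-- Pays for the extra degree of the β-part. In α^(n+2) = α^(n+1) + α^n the last summand, doubled,
-- covers the increment 1.
n≼2α^n : ∀ n → ι n ≼ 2₅ *₅ (α ^₅ n)
n≼2α^n zero          = subst (_≼ 2₅ *₅ 1₅) (sym ι-zero) (below (Cone-+ Cone-1 Cone-1))
n≼2α^n (suc zero)    = subst (_≼ 2₅ *₅ (α ^₅ 1)) (sym (trans (ι-suc 0) (cong (_+₅ 1₅) ι-zero))) (1≼2α^ 1)
n≼2α^n (suc (suc n)) = below (subst Cone
  (trans (lem (ι (suc n)) (α ^₅ n)) (cong (λ z → 2₅ *₅ (α ^₅ suc (suc n)) -₅ z) (sym (ι-suc (suc n)))))
  (Cone-+ (_≼_.difference (n≼2α^n (suc n))) (_≼_.difference (1≼2α^ n))))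
  where
  lem : ∀ k x → ((1₅ +₅ 1₅) *₅ (α *₅ x) -₅ k) +₅ ((1₅ +₅ 1₅) *₅ x -₅ 1₅) ≡ (1₅ +₅ 1₅) *₅ (α *₅ (α *₅ x)) -₅ (k +₅ 1₅)
  lem = solve-∀ Q5-ring

-- Since 2 - α = α⁻², the difference is α^(2m). The powers are essential: 2 - α alone has
-- √5-coordinate -½.
α*α^²≼2α^² : ∀ m → α *₅ (α ^₅ suc m *₅ α ^₅ suc m) ≼ 2₅ *₅ (α ^₅ suc m *₅ α ^₅ suc m)
α*α^²≼2α^² m = below (subst Cone (lem (α ^₅ m)) (Cone-* (Cone-α^ m) (Cone-α^ m)))
  where
  lem : ∀ x → x *₅ x ≡ (1₅ +₅ 1₅) *₅ ((α *₅ x) *₅ (α *₅ x)) -₅ α *₅ ((α *₅ x) *₅ (α *₅ x))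
  lem = solve-∀ Q5-ring

βα^≪1 : ∀ n → β ^₅ n *₅ α ^₅ n ≪ 1₅
βα^≪1 zero    = Cone⇒≪-refl Cone-1
βα^≪1 (suc n) with βα^≪1 n
-- Because βα = -1, each step exchanges the two bounds.
... | between p q = between (subst Cone (lem₁ (β ^₅ n) (α ^₅ n)) q) (subst Cone (lem₂ (β ^₅ n) (α ^₅ n)) p)
  where
  lem₁ : ∀ x y → 1₅ -₅ x *₅ y ≡ 1₅ +₅ (β *₅ x) *₅ (α *₅ y)
  lem₁ = solve-∀ Q5-ring
  lem₂ : ∀ x y → 1₅ +₅ x *₅ y ≡ 1₅ -₅ (β *₅ x) *₅ (α *₅ y)
  lem₂ = solve-∀ Q5-ring

^₅-+2 : ∀ u n → u ^₅ (n ℕ.+ 2) ≡ u ^₅ n *₅ (u *₅ u)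
^₅-+2 u zero    = lem u
  where
  lem : ∀ u → u *₅ (u *₅ 1₅) ≡ 1₅ *₅ (u *₅ u)
  lem = solve-∀ Q5-ring
^₅-+2 u (suc n) = trans (cong (u *₅_) (^₅-+2 u n)) (sym (*₅-assoc u (u ^₅ n) (u *₅ u)))

-- The error estimate

mainTerm-lead : ∀ a b n → mainTerm a b n ≡ lead a b *₅ (ι n ^₅ (2 ℕ.* a ℕ.+ b)) *₅ (α ^₅ n)
mainTerm-lead a b n = trans
  (cong₂ (λ k x → (fromℚ ½ ^₅ a) *₅ (√5⁻¹ ^₅ (a ℕ.+ b ℕ.+ 1)) *₅ (k ^₅ D) *₅ x *₅ (α⁻¹ ^₅ (a ℕ.+ b))) (sym (ι≡fromℕ n)) (^₅-+2 α n))
  (lem (fromℚ ½ ^₅ a) (√5⁻¹ ^₅ (a ℕ.+ b ℕ.+ 1)) (ι n ^₅ D) (α ^₅ n) (α⁻¹ ^₅ (a ℕ.+ b)))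
  where
  D = 2 ℕ.* a ℕ.+ b
  lem : ∀ h s k x t → h *₅ s *₅ k *₅ (x *₅ (α *₅ α)) *₅ t ≡ h *₅ s *₅ (α *₅ α) *₅ t *₅ k *₅ x
  lem = solve-∀ Q5-ring

≪-α^⇒AbsLe : ∀ n d e → d *₅ (α ^₅ n) ≪ e *₅ (α ^₅ n) → AbsLe d e
≪-α^⇒AbsLe n d e (between lower upper) =
  Cone-α^⇒NonNeg n (subst Cone (lem₁ d e (α ^₅ n)) lower) , Cone-α^⇒NonNeg n (subst Cone (lem₂ d e (α ^₅ n)) upper)
  where
  lem₁ : ∀ d e x → e *₅ x +₅ d *₅ x ≡ (d -₅ (-₅ e)) *₅ x
  lem₁ = solve-∀ Q5-ring
  lem₂ : ∀ d e x → e *₅ x -₅ d *₅ x ≡ (e -₅ d) *₅ x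
  lem₂ = solve-∀ Q5-ring

HasLead⇒bound : ∀ a b → HasLead a b → Σ ℕ λ C → ∀ m →
  AbsLe (fromℕ (G⁺ a b (suc m)) -₅ mainTerm a b (suc m)) (fromℕ C *₅ errScale a b m)
HasLead⇒bound a b (expPoly {P} {Q} (leading P₁ PolyP₁ P≡) PolyQ closed-form) = C , λ m →
  ≪-α^⇒AbsLe (suc m) (fromℕ (G⁺ a b (suc m)) -₅ mainTerm a b (suc m)) (fromℕ C *₅ errScale a b m)
    (subst₂ _≪_ (sym (difference m)) (error-term m) (combined m))
  where
  D = 2 ℕ.* a ℕ.+ b
  C₁ = proj₁ (Poly-bound PolyP₁)
  C₂ = proj₁ (Poly-bound PolyQ)
  -- Doubled because absorbing α in the one term and n in the other each costs a factor 2.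
  C = (C₁ ℕ.+ C₂) ℕ.+ (C₁ ℕ.+ C₂)
  module _ (m : ℕ) where
    n n⁻¹ E x y : Q5
    n   = ι (suc m)
    n⁻¹ = fromℚ (+ 1 / suc m)
    E   = n ^₅ D *₅ n⁻¹
    x   = α ^₅ suc m
    y   = β ^₅ suc m
    ConeE : Cone E
    ConeE = Cone-* (Cone-^ D (Cone-ι (suc m))) (Cone-1/ m)
    difference : (fromℕ (G⁺ a b (suc m)) -₅ mainTerm a b (suc m)) *₅ x ≡ P₁ (suc m) *₅ (x *₅ x) +₅ Q (suc m) *₅ (y *₅ x)
    difference = trans
      (cong₂ (λ u v → (u -₅ v) *₅ x)
        (trans (sym (ι≡fromℕ (G⁺ a b (suc m)))) (trans (cong ι (G⁺≡total a b (suc m))) (trans (closed-form (suc m)) (cong (λ u → u *₅ x +₅ Q (suc m) *₅ y) (P≡ (suc m))))))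
        (mainTerm-lead a b (suc m)))
      (lem (lead a b *₅ (n ^₅ D)) (P₁ (suc m)) (Q (suc m)) x y)
      where
      lem : ∀ l p q x y → ((l +₅ p) *₅ x +₅ q *₅ y -₅ l *₅ x) *₅ x ≡ p *₅ (x *₅ x) +₅ q *₅ (y *₅ x)
      lem = solve-∀ Q5-ring
    lower-terms : P₁ (suc m) *₅ (x *₅ x) ≪ ι C₁ *₅ E *₅ (2₅ *₅ (x *₅ x))
    lower-terms = ≪-≼-trans
      (subst (P₁ (suc m) *₅ (x *₅ x) ≪_) (lem (ι C₁) α E (x *₅ x))
        (≪-* (proj₂ (Poly-bound PolyP₁) m) (Cone⇒≪-refl (Cone-* (Cone-α^ (suc m)) (Cone-α^ (suc m))))))
      (≼-* Cone-C₁E (Cone-* (Cone-+ Cone-1 Cone-1) (Cone-* (Cone-α^ (suc m)) (Cone-α^ (suc m)))) (≼-refl (ι C₁ *₅ E)) (α*α^²≼2α^² m))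
      where
      Cone-C₁E = Cone-* (Cone-ι C₁) ConeE
      lem : ∀ c a e z → c *₅ a *₅ e *₅ z ≡ c *₅ e *₅ (a *₅ z)
      lem = solve-∀ Q5-ring
    -- The top term of Q does not cancel, so Q(n) is only bounded by a multiple of α n E. As βⁿαⁿ is
    -- bounded by 1, it remains to absorb α n into αⁿ · 2αⁿ.
    conjugate-terms : Q (suc m) *₅ (y *₅ x) ≪ ι C₂ *₅ E *₅ (x *₅ (2₅ *₅ x))
    conjugate-terms = ≪-≼-trans
      (subst (Q (suc m) *₅ (y *₅ x) ≪_) (lem (ι C₂) α n (n ^₅ D) n⁻¹)
        (≪-* (proj₂ (Poly-bound PolyQ) m) (βα^≪1 (suc m))))
      (≼-* (Cone-* (Cone-ι C₂) ConeE) (Cone-* (Cone-α^ (suc m)) (Cone-* (Cone-+ Cone-1 Cone-1) (Cone-α^ (suc m)))) (≼-refl (ι C₂ *₅ E))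
        (≼-* Cone-α (Cone-* (Cone-+ Cone-1 Cone-1) (Cone-α^ (suc m))) (α≼α^suc m) (n≼2α^n (suc m))))
      where
      lem : ∀ c a k p i → c *₅ a *₅ (k *₅ p *₅ i) *₅ 1₅ ≡ c *₅ (p *₅ i) *₅ (a *₅ k)
      lem = solve-∀ Q5-ring
    combined : P₁ (suc m) *₅ (x *₅ x) +₅ Q (suc m) *₅ (y *₅ x) ≪ ι C₁ *₅ E *₅ (2₅ *₅ (x *₅ x)) +₅ ι C₂ *₅ E *₅ (x *₅ (2₅ *₅ x))
    combined = ≪-+ lower-terms conjugate-terms
    error-term : ι C₁ *₅ E *₅ (2₅ *₅ (x *₅ x)) +₅ ι C₂ *₅ E *₅ (x *₅ (2₅ *₅ x)) ≡ fromℕ C *₅ errScale a b m *₅ x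
    error-term = trans (lem (ι C₁) (ι C₂) E x)
      (cong₂ (λ u v → u *₅ (v ^₅ D *₅ n⁻¹ *₅ x) *₅ x)
        (trans (cong (λ u → u +₅ u) (sym (ι-+ C₁ C₂))) (trans (sym (ι-+ (C₁ ℕ.+ C₂) (C₁ ℕ.+ C₂))) (ι≡fromℕ C)))
        (ι≡fromℕ (suc m)))
      where
      lem : ∀ c d e x → c *₅ e *₅ ((1₅ +₅ 1₅) *₅ (x *₅ x)) +₅ d *₅ e *₅ (x *₅ ((1₅ +₅ 1₅) *₅ x))
        ≡ ((c +₅ d) +₅ (c +₅ d)) *₅ (e *₅ x) *₅ x
      lem = solve-∀ Q5-ring

theorem6p1 : (a b : ℕ) →
    Σ ℕ λ C → Σ ℕ λ N → (m : ℕ) → N ≤ m →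
    AbsLe (fromℕ (G⁺ a b (suc m)) -₅ mainTerm a b (suc m)) (fromℕ C *₅ errScale a b m)
-- The estimate holds for every n = m + 1 ≥ 1, so the threshold is 0.
theorem6p1 a b = proj₁ bounded , 0 , λ m _ → proj₂ bounded m
  where
  bounded = HasLead⇒bound a b (hasLead a b)
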